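{- Let $n\geq 4$ and let $\mathcal{T}_n$ denote the set of trees on $n$ vertices. If $T\in\mathcal{T}_n$ and $T$ is not isomorphic to the balanced double star $S_{\lfloor\frac{n-2}{2}\rfloor,\lceil\frac{n-2}{2}\rceil}$, then $T$ is not maximal with respect to $e^{M_2}$ over $\mathcal{T}_n$, i.e., there exists $T''\in\mathcal{T}_n$ with $e^{M_2}(T'')>e^{M_2}(T)$.
   Context: For a tree (graph) $G$ with edge set $E(G)$ and vertex degrees $d_G(v)$, the exponential of the second Zagreb index is $e^{M_2}(G)=\sum_{uv\in E(G)} e^{d_G(u)d_G(v)}$. For integers $x,y\geq 1$, the double star $S_{x,y}$ is the tree on $x+y+2$ vertices with exactly two non-pendent vertices, of degrees $x+1$ and $y+1$ (these two vertices are adjacent, the first has $x$ pendant neighbours and the second has $y$ pendant neighbours). -}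

module Defs where

open import Data.Bool.Base using (Bool; true; false; T)
open import Data.Fin.Base as Fin using (Fin; zero; suc; splitAt)
import Data.Fin.Properties as Fin
open import Data.Integer.Base as ℤ using (+_; +≤+; +<+)
import Data.Integer.Properties as ℤ
open import Data.List.Base
  using (List; []; _∷_; _∷ʳ_; length; map; foldr; filter; allFin; cartesianProduct)
open import Data.List.Relation.Unary.Linked using (Linked)
open import Data.List.Relation.Unary.Unique.Propositional using (Unique)
open import Data.Nat.Base as ℕ using (ℕ; zero; suc; _!; _^_; _⊔_)
import Data.Nat.Properties as ℕ
open import Data.Nat.Solver using (module +-*-Solver)
open import Data.Product.Base using (Σ-syntax; ∃-syntax; _×_; _,_; proj₁; proj₂)
open import Data.Rational.Base as ℚ
  using (ℚ; mkℚ; 0ℚ; ½; ∣_∣; _+_; _*_; _-_; -_; _/_; _≤_; _<_; toℚᵘ; fromℚᵘ)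
import Data.Rational.Properties as ℚ
import Data.Rational.Solver as ℚSolver
open import Data.Rational.Unnormalised.Base as ℚᵘ using (mkℚᵘ)
import Data.Rational.Unnormalised.Properties as ℚᵘ
open import Data.Sum.Base using ([_,_]′)
open import Function.Base using (const)
open import Function.Bundles using (_↔_; _⇔_; Inverse)
open import Level using (0ℓ)
open import Relation.Binary.Construct.Closure.ReflexiveTransitive using (Star)
open import Relation.Binary.Core using (Rel)
open import Relation.Binary.Definitions using (Decidable; Symmetric; Irreflexive)
open import Relation.Binary.PropositionalEquality
open import Relation.Nullary.Decidable.Core using (T?; _×-dec_)
open import Relation.Nullary.Negation.Core using (¬_)

-- Reals are presented by rational Cauchy sequences; distinct sequences may
-- have the same limit, and only the order _<ℝ_ below is used to compare them.
record ℝ : Set where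
  field
    seq    : ℕ → ℚ
    cauchy : ∀ {ε} → 0ℚ < ε →
             ∃[ N ] (∀ m n → N ℕ.≤ m → N ℕ.≤ n → ∣ seq m - seq n ∣ < ε)

open ℝ public

infix 4 _<ℝ_ _>ℝ_

-- A positive rational must separate the sequences: pointwise _<_ would not
-- give strict inequality of the limits.
_<ℝ_ : ℝ → ℝ → Set
x <ℝ y = ∃[ ε ] (0ℚ < ε × ∃[ N ] (∀ m → N ℕ.≤ m → seq x m + ε ≤ seq y m))

_>ℝ_ : ℝ → ℝ → Set
x >ℝ y = y <ℝ x

0ℝ : ℝ
0ℝ = record { seq = const 0ℚ ; cauchy = λ 0<ε → 0 , λ _ _ _ _ → 0<ε }

halves : ∀ ε → ε * ½ + ε * ½ ≡ ε
halves ε = trans (sym (ℚ.*-distribˡ-+ ε ½ ½)) (ℚ.*-identityʳ ε)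

half-pos : ∀ {ε} → 0ℚ < ε → 0ℚ < ε * ½
half-pos {ε} 0<ε = subst (_< ε * ½) (ℚ.*-zeroˡ ½) (ℚ.*-monoˡ-<-pos ½ 0<ε)

interchange : ∀ a b c d → (a + b) - (c + d) ≡ (a - c) + (b - d)
interchange = solve 4
  (λ a b c d → (a :+ b) :- (c :+ d) := (a :- c) :+ (b :- d)) refl
  where open ℚSolver.+-*-Solver

infixl 6 _+ℝ_

_+ℝ_ : ℝ → ℝ → ℝ
x +ℝ y = record
  { seq    = λ m → seq x m + seq y m
  ; cauchy = λ {ε} 0<ε →
      let (M , p) = cauchy x (half-pos 0<ε)
          (N , q) = cauchy y (half-pos 0<ε)
      in M ⊔ N , λ m n h k → begin-strict
        ∣ (seq x m + seq y m) - (seq x n + seq y n) ∣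
          ≡⟨ cong ∣_∣ (interchange (seq x m) (seq y m) (seq x n) (seq y n)) ⟩
        ∣ (seq x m - seq x n) + (seq y m - seq y n) ∣
          ≤⟨ ℚ.∣p+q∣≤∣p∣+∣q∣ (seq x m - seq x n) (seq y m - seq y n) ⟩
        ∣ seq x m - seq x n ∣ + ∣ seq y m - seq y n ∣
          <⟨ ℚ.+-mono-< (p m n (ℕ.m⊔n≤o⇒m≤o M N h) (ℕ.m⊔n≤o⇒m≤o M N k))
                        (q m n (ℕ.m⊔n≤o⇒n≤o M N h) (ℕ.m⊔n≤o⇒n≤o M N k)) ⟩
        ε * ½ + ε * ½
          ≡⟨ halves ε ⟩
        ε ∎
  }
  where open ℚ.≤-Reasoning

sumℝ : List ℝ → ℝ
sumℝ = foldr _+ℝ_ 0ℝ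

-- e^k is the limit over m of Σ_{i<m} k^i / i!.
expTerm : ℕ → ℕ → ℚ
expTerm k i = _/_ (+ (k ^ i)) (i !) ⦃ i ℕ.!≢0 ⦄

expSum : ℕ → ℕ → ℚ
expSum k zero    = 0ℚ
expSum k (suc m) = expSum k m + expTerm k m

/-≃ : ∀ a b .⦃ _ : ℕ.NonZero b ⦄ → toℚᵘ (+ a / b) ℚᵘ.≃ (+ a ℚᵘ./ b)
/-≃ a (suc b) = ℚ.toℚᵘ-fromℚᵘ (mkℚᵘ (+ a) b)

/-≤ : ∀ a b c d .⦃ _ : ℕ.NonZero b ⦄ .⦃ _ : ℕ.NonZero d ⦄ →
      a ℕ.* d ℕ.≤ c ℕ.* b → + a / b ≤ + c / d
/-≤ a b@(suc _) c d@(suc _) h = ℚ.toℚᵘ-cancel-≤ (begin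
  toℚᵘ (+ a / b) ≃⟨ /-≃ a b ⟩
  + a ℚᵘ./ b     ≤⟨ ℚᵘ.*≤* (subst₂ ℤ._≤_ (ℤ.pos-* a d) (ℤ.pos-* c b) (+≤+ h)) ⟩
  + c ℚᵘ./ d     ≃⟨ /-≃ c d ⟨
  toℚᵘ (+ c / d) ∎)
  where open ℚᵘ.≤-Reasoning

/-< : ∀ a b c d .⦃ _ : ℕ.NonZero b ⦄ .⦃ _ : ℕ.NonZero d ⦄ →
      a ℕ.* d ℕ.< c ℕ.* b → + a / b < + c / d
/-< a b@(suc _) c d@(suc _) h = ℚ.toℚᵘ-cancel-< (begin-strict
  toℚᵘ (+ a / b) ≃⟨ /-≃ a b ⟩
  + a ℚᵘ./ b     <⟨ ℚᵘ.*<* (subst₂ ℤ._<_ (ℤ.pos-* a d) (ℤ.pos-* c b) (+<+ h)) ⟩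
  + c ℚᵘ./ d     ≃⟨ /-≃ c d ⟨
  toℚᵘ (+ c / d) ∎)
  where open ℚᵘ.≤-Reasoning

/-double : ∀ a b .⦃ _ : ℕ.NonZero b ⦄ → + a / b + + a / b ≡ + (2 ℕ.* a) / b
/-double a b@(suc _) = ℚ.toℚᵘ-injective (begin
  toℚᵘ (+ a / b + + a / b)               ≈⟨ ℚ.toℚᵘ-homo-+ (+ a / b) (+ a / b) ⟩
  toℚᵘ (+ a / b) ℚᵘ.+ toℚᵘ (+ a / b)     ≈⟨ ℚᵘ.+-cong (/-≃ a b) (/-≃ a b) ⟩
  (+ a ℚᵘ./ b) ℚᵘ.+ (+ a ℚᵘ./ b)         ≈⟨ ℚᵘ.*≡* numerators ⟩
  + (2 ℕ.* a) ℚᵘ./ b                     ≈⟨ /-≃ (2 ℕ.* a) b ⟨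
  toℚᵘ (+ (2 ℕ.* a) / b)                 ∎)
  where
  open ℚᵘ.≃-Reasoning
  numerators : (+ a ℤ.* + b ℤ.+ + a ℤ.* + b) ℤ.* + b ≡ + (2 ℕ.* a) ℤ.* + (b ℕ.* b)
  numerators = trans
    (cong (ℤ._* + b) (cong₂ ℤ._+_ (sym (ℤ.pos-* a b)) (sym (ℤ.pos-* a b))))
    (trans (sym (ℤ.pos-* (a ℕ.* b ℕ.+ a ℕ.* b) b))
    (trans (cong +_ (solve 2 (λ x y →
               (x :* y :+ x :* y) :* y := (con 2 :* x) :* (y :* y)) refl a b))
           (ℤ.pos-* (2 ℕ.* a) (b ℕ.* b))))
    where open +-*-Solver

expTerm-nonNeg : ∀ k i → 0ℚ ≤ expTerm k i
expTerm-nonNeg k i = /-≤ 0 1 (k ^ i) (i !) ⦃ _ ⦄ ⦃ i ℕ.!≢0 ⦄ ℕ.z≤n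

-- Beyond i = 2k the terms at least halve.
expTerm-halves : ∀ k i → 2 ℕ.* k ℕ.≤ i →
                 expTerm k (suc i) + expTerm k (suc i) ≤ expTerm k i
expTerm-halves k i h = subst (_≤ expTerm k i)
  (sym (/-double (k ^ suc i) (suc i !) ⦃ suc i ℕ.!≢0 ⦄))
  (/-≤ (2 ℕ.* (k ^ suc i)) (suc i !) (k ^ i) (i !) ⦃ suc i ℕ.!≢0 ⦄ ⦃ i ℕ.!≢0 ⦄ (begin
    2 ℕ.* (k ℕ.* k ^ i) ℕ.* i !   ≡⟨ rearrange k (k ^ i) (i !) ⟩
    2 ℕ.* k ℕ.* (k ^ i ℕ.* i !)   ≤⟨ ℕ.*-monoˡ-≤ _ (ℕ.m≤n⇒m≤1+n h) ⟩
    suc i ℕ.* (k ^ i ℕ.* i !)     ≡⟨ swap (suc i) (k ^ i) (i !) ⟩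
    k ^ i ℕ.* (suc i ℕ.* i !)     ∎))
  where
  open ℕ.≤-Reasoning
  open +-*-Solver
  rearrange : ∀ k p f → 2 ℕ.* (k ℕ.* p) ℕ.* f ≡ 2 ℕ.* k ℕ.* (p ℕ.* f)
  rearrange = solve 3 (λ k p f → con 2 :* (k :* p) :* f := con 2 :* k :* (p :* f)) refl
  swap : ∀ s p f → s ℕ.* (p ℕ.* f) ≡ p ℕ.* (s ℕ.* f)
  swap = solve 3 (λ s p f → s :* (p :* f) := p :* (s :* f)) refl

expSum-mono : ∀ k m d → expSum k m ≤ expSum k (d ℕ.+ m)
expSum-mono k m zero    = ℚ.≤-refl
expSum-mono k m (suc d) = begin
  expSum k m                                   ≤⟨ expSum-mono k m d ⟩
  expSum k (d ℕ.+ m)                           ≡⟨ ℚ.+-identityʳ _ ⟨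
  expSum k (d ℕ.+ m) + 0ℚ                      ≤⟨ ℚ.+-monoʳ-≤ (expSum k (d ℕ.+ m)) (expTerm-nonNeg k (d ℕ.+ m)) ⟩
  expSum k (d ℕ.+ m) + expTerm k (d ℕ.+ m)     ∎
  where open ℚ.≤-Reasoning

expTail : ℕ → ℕ → ℚ
expTail k m = expTerm k m + expTerm k m

expSum+expTail-anti : ∀ k m d → 2 ℕ.* k ℕ.≤ m →
                   expSum k (d ℕ.+ m) + expTail k (d ℕ.+ m) ≤ expSum k m + expTail k m
expSum+expTail-anti k m zero    h = ℚ.≤-refl
expSum+expTail-anti k m (suc d) h = begin
  (S + t) + (t′ + t′)   ≤⟨ ℚ.+-monoʳ-≤ (S + t) (expTerm-halves k (d ℕ.+ m) (ℕ.≤-trans h (ℕ.m≤n+m m d))) ⟩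
  (S + t) + t           ≡⟨ ℚ.+-assoc S t t ⟩
  S + (t + t)           ≤⟨ expSum+expTail-anti k m d h ⟩
  expSum k m + expTail k m ∎
  where
  open ℚ.≤-Reasoning
  S = expSum k (d ℕ.+ m)
  t = expTerm k (d ℕ.+ m)
  t′ = expTerm k (suc (d ℕ.+ m))

expSum-bounds : ∀ k N → 2 ℕ.* k ℕ.≤ N → ∀ m → N ℕ.≤ m →
                expSum k N ≤ expSum k m × expSum k m ≤ expSum k N + expTail k N
expSum-bounds k N h m N≤m =
  subst (λ m → expSum k N ≤ expSum k m × expSum k m ≤ expSum k N + expTail k N)
        (ℕ.m∸n+n≡m N≤m) (expSum-mono k N d , upper)
  where
  open ℚ.≤-Reasoning
  d = m ℕ.∸ N
  t = expTerm k (d ℕ.+ N)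
  upper : expSum k (d ℕ.+ N) ≤ expSum k N + expTail k N
  upper = begin
    expSum k (d ℕ.+ N)                     ≡⟨ ℚ.+-identityʳ _ ⟨
    expSum k (d ℕ.+ N) + 0ℚ                ≤⟨ ℚ.+-monoʳ-≤ (expSum k (d ℕ.+ N))
                                                (ℚ.+-mono-≤ (expTerm-nonNeg k (d ℕ.+ N)) (expTerm-nonNeg k (d ℕ.+ N))) ⟩
    expSum k (d ℕ.+ N) + expTail k (d ℕ.+ N)  ≤⟨ expSum+expTail-anti k N d h ⟩
    expSum k N + expTail k N                  ∎

∣-∣-within : ∀ {a b s t} → s ≤ a → a ≤ s + t → s ≤ b → b ≤ s + t → ∣ a - b ∣ ≤ t
∣-∣-within {a} {b} {s} {t} s≤a a≤s+t s≤b b≤s+t =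
  [ (λ eq → subst (_≤ t) (sym eq) (difference a≤s+t s≤b))
  , (λ eq → subst (_≤ t) (sym (trans eq flip)) (difference b≤s+t s≤a))
  ]′ (ℚ.∣p∣≡p∨∣p∣≡-p (a - b))
  where
  open ℚSolver.+-*-Solver
  flip : - (a - b) ≡ b - a
  flip = solve 2 (λ a b → :- (a :- b) := b :- a) refl a b
  difference : ∀ {c d} → c ≤ s + t → s ≤ d → c - d ≤ t
  difference c≤s+t s≤d = ℚ.≤-trans (ℚ.+-mono-≤ c≤s+t (ℚ.neg-antimono-≤ s≤d))
    (ℚ.≤-reflexive (solve 2 (λ s t → (s :+ t) :- s := t) refl s t))

power-bound : ∀ k j → let i = j ℕ.+ 2 ℕ.* k in
              k ^ i ℕ.* 2 ^ j ℕ.≤ k ^ (2 ℕ.* k) ℕ.* i !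
power-bound k zero    = ℕ.*-monoʳ-≤ (k ^ (2 ℕ.* k)) (ℕ.1≤n! (2 ℕ.* k))
power-bound k (suc j) = begin
  k ℕ.* k ^ i ℕ.* (2 ℕ.* 2 ^ j)           ≡⟨ rearrange k (k ^ i) (2 ^ j) ⟩
  2 ℕ.* k ℕ.* (k ^ i ℕ.* 2 ^ j)           ≤⟨ ℕ.*-mono-≤ (ℕ.m≤n⇒m≤1+n (ℕ.m≤n+m (2 ℕ.* k) j)) (power-bound k j) ⟩
  suc i ℕ.* (k ^ (2 ℕ.* k) ℕ.* i !)       ≡⟨ swap (suc i) (k ^ (2 ℕ.* k)) (i !) ⟩
  k ^ (2 ℕ.* k) ℕ.* (suc i ℕ.* i !)       ∎
  where
  open ℕ.≤-Reasoning
  open +-*-Solver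
  i = j ℕ.+ 2 ℕ.* k
  rearrange : ∀ k p q → k ℕ.* p ℕ.* (2 ℕ.* q) ≡ 2 ℕ.* k ℕ.* (p ℕ.* q)
  rearrange = solve 3 (λ k p q → k :* p :* (con 2 :* q) := con 2 :* k :* (p :* q)) refl
  swap : ∀ s p f → s ℕ.* (p ℕ.* f) ≡ p ℕ.* (s ℕ.* f)
  swap = solve 3 (λ s p f → s :* (p :* f) := p :* (s :* f)) refl

1+n≤2^n : ∀ n → suc n ℕ.≤ 2 ^ n
1+n≤2^n zero    = ℕ.≤-refl
1+n≤2^n (suc n) = begin
  suc (suc n)           ≡⟨ ℕ.+-comm 1 (suc n) ⟩
  suc n ℕ.+ 1           ≤⟨ ℕ.+-mono-≤ (1+n≤2^n n) (ℕ.≤-trans (ℕ.s≤s ℕ.z≤n) (1+n≤2^n n)) ⟩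
  2 ^ n ℕ.+ 2 ^ n       ≡⟨ cong (2 ^ n ℕ.+_) (ℕ.+-identityʳ (2 ^ n)) ⟨
  2 ℕ.* 2 ^ n           ∎
  where open ℕ.≤-Reasoning

1/n≤ : ∀ {ε} → 0ℚ < ε → + 1 / ℚ.↧ₙ ε ≤ ε
1/n≤ {ε@(mkℚ (+ suc a) b-1 _)} _ = subst (+ 1 / suc b-1 ≤_) (ℚ.fromℚᵘ-toℚᵘ ε)
  (/-≤ 1 (suc b-1) (suc a) (suc b-1) (ℕ.*-monoˡ-≤ (suc b-1) (ℕ.s≤s (ℕ.z≤n {a}))))
1/n≤ {mkℚ (+ zero) _ _} (ℚ.*<* (+<+ ()))
1/n≤ {mkℚ ℤ.-[1+ _ ] _ _} (ℚ.*<* ())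

expTail-small : ∀ k {ε} → 0ℚ < ε → ∃[ N ] (2 ℕ.* k ℕ.≤ N × expTail k N < ε)
expTail-small k {ε} 0<ε = N , ℕ.m≤n+m (2 ℕ.* k) j , (begin-strict
  expTail k N                  ≡⟨ /-double (k ^ N) (N !) ⦃ N ℕ.!≢0 ⦄ ⟩
  _/_ (+ (2 ℕ.* k ^ N)) (N !) ⦃ N ℕ.!≢0 ⦄
    ≤⟨ /-≤ (2 ℕ.* k ^ N) (N !) (2 ℕ.* p) (2 ^ j) ⦃ N ℕ.!≢0 ⦄ ⦃ 2^j≢0 ⦄ bound ⟩
  _/_ (+ (2 ℕ.* p)) (2 ^ j) ⦃ 2^j≢0 ⦄
    <⟨ /-< (2 ℕ.* p) (2 ^ j) 1 b ⦃ 2^j≢0 ⦄ below ⟩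
  + 1 / b                   ≤⟨ 1/n≤ 0<ε ⟩
  ε                         ∎)
  where
  open ℚ.≤-Reasoning
  b = ℚ.↧ₙ ε
  p = k ^ (2 ℕ.* k)
  j = 2 ℕ.* p ℕ.* b
  N = j ℕ.+ 2 ℕ.* k
  2^j≢0 : ℕ.NonZero (2 ^ j)
  2^j≢0 = ℕ.m^n≢0 2 j
  bound : 2 ℕ.* k ^ N ℕ.* 2 ^ j ℕ.≤ 2 ℕ.* p ℕ.* N !
  bound = subst₂ ℕ._≤_ (sym (ℕ.*-assoc 2 (k ^ N) (2 ^ j))) (sym (ℕ.*-assoc 2 p (N !)))
                 (ℕ.*-monoʳ-≤ 2 (power-bound k j))
  below : j ℕ.< 1 ℕ.* 2 ^ j
  below = subst (j ℕ.<_) (sym (ℕ.*-identityˡ (2 ^ j))) (1+n≤2^n j)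

exp : ℕ → ℝ
exp k = record
  { seq    = expSum k
  ; cauchy = λ 0<ε →
      let (N , 2k≤N , small) = expTail-small k 0<ε
          bounds = expSum-bounds k N 2k≤N
      in N , λ m n N≤m N≤n → ℚ.≤-<-trans
           (∣-∣-within (proj₁ (bounds m N≤m)) (proj₂ (bounds m N≤m))
                       (proj₁ (bounds n N≤n)) (proj₂ (bounds n N≤n)))
           small
  }

record Graph (n : ℕ) : Set₁ where
  infix 4 _~_ _~?_
  field
    _~_      : Rel (Fin n) 0ℓ
    _~?_     : Decidable _~_
    ~-sym    : Symmetric _~_
    ~-irrefl : Irreflexive _≡_ _~_

  degree : Fin n → ℕ
  degree v = length (filter (v ~?_) (allFin n))

  -- Each edge is listed once, with its smaller endpoint first.
  edges : List (Fin n × Fin n)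
  edges = filter (λ (u , v) → (u Fin.<? v) ×-dec (u ~? v))
                 (cartesianProduct (allFin n) (allFin n))

  Connected : Set
  Connected = ∀ u v → Star _~_ u v

  record Cycle : Set where
    field
      start    : Fin n
      rest     : List (Fin n)
      long     : 2 ℕ.≤ length rest
      distinct : Unique (start ∷ rest)
      closed   : Linked _~_ (start ∷ rest ∷ʳ start)

  Acyclic : Set
  Acyclic = ¬ Cycle

  -- Connected also holds of the empty graph, hence the first field.
  record IsTree : Set where
    field
      nonEmpty  : 1 ℕ.≤ n
      connected : Connected
      acyclic   : Acyclic

open Graph public using (IsTree)

infix 4 _≅_

_≅_ : ∀ {m n} → Graph m → Graph n → Set
_≅_ {m} {n} G H = Σ[ f ∈ Fin m ↔ Fin n ]
  (∀ u v → u G.~ v ⇔ Inverse.to f u H.~ Inverse.to f v)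
  where
  module G = Graph G
  module H = Graph H

eM₂ : ∀ {n} → Graph n → ℝ
eM₂ G = sumℝ (map (λ (u , v) → exp (degree u ℕ.* degree v)) edges)
  where open Graph G

data Role : Set where
  centre₁ centre₂ leaf₁ leaf₂ : Role

joined : Role → Role → Bool
joined centre₁ centre₂ = true
joined centre₂ centre₁ = true
joined centre₁ leaf₁   = true
joined leaf₁   centre₁ = true
joined centre₂ leaf₂   = true
joined leaf₂   centre₂ = true
joined _       _       = false

joined-sym : ∀ r s → T (joined r s) → T (joined s r)
joined-sym centre₁ centre₂ _ = _
joined-sym centre₂ centre₁ _ = _
joined-sym centre₁ leaf₁   _ = _
joined-sym leaf₁   centre₁ _ = _
joined-sym centre₂ leaf₂   _ = _
joined-sym leaf₂   centre₂ _ = _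

joined-irrefl : ∀ r → ¬ T (joined r r)
joined-irrefl centre₁ ()
joined-irrefl centre₂ ()
joined-irrefl leaf₁   ()
joined-irrefl leaf₂   ()

-- S_{x,y}, meant for x, y ≥ 1 (otherwise a centre is pendent and it is a star).
-- Vertices 0 and 1 are the centres; they are followed by the x leaves at 0
-- and then the y leaves at 1.
role : ∀ x y → Fin (2 ℕ.+ (x ℕ.+ y)) → Role
role x y zero          = centre₁
role x y (suc zero)    = centre₂
role x y (suc (suc i)) = [ const leaf₁ , const leaf₂ ]′ (splitAt x i)

doubleStar : ∀ x y → Graph (2 ℕ.+ (x ℕ.+ y))
doubleStar x y = record
  { _~_      = λ u v → T (joined (role x y u) (role x y v))
  ; _~?_     = λ u v → T? (joined (role x y u) (role x y v))
  ; ~-sym    = λ {u} {v} → joined-sym (role x y u) (role x y v)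
  ; ~-irrefl = λ { {u} refl → joined-irrefl (role x y u) }
  }

{-# OPTIONS --safe #-}
-- Write n = X + Y with X ≤ Y ≤ X + 1 and let S be the balanced double star, so
-- that eM₂ S > e^{XY}. The ends of an edge of a tree have disjoint
-- neighbourhoods, so their degrees sum to at most n.
--
-- If every such sum is below n, each of the at most XY edges (Mantel's bound)
-- contributes at most e^{X(Y-1)}, and XY < e^X, as follows from e² > 6 and e ≥ 2.
-- If some sum is n, the tree is a double star or a star. In an unbalanced double
-- star the central edge contributes at most e^{XY-1} < e^{XY}/2, and the pendent
-- edges are negligible. For a star the uniform bound works again, except for
-- n = 4, which is checked numerically.
module Submission where

open import Defs
import Algebra.Properties.Semiring.Mult as Mult
open import Algebra.Bundles using (CommutativeRing)
open import Data.Bool.Base using (T)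
open import Data.Empty using (⊥; ⊥-elim)
open import Data.Fin.Base as Fin using (Fin; zero; suc; splitAt; _↑ˡ_; _↑ʳ_)
import Data.Fin.Properties as Fin
open import Data.Integer.Base as ℤ using (+_)
import Data.Integer.Properties as ℤ
open import Data.List.Base
  using (List; []; _∷_; _++_; length; map; filter; allFin; cartesianProduct; lookup; concatMap)
import Data.List.Properties as List
open import Data.List.Membership.Propositional using (_∈_; find)
open import Data.List.Membership.Propositional.Properties
  using (∈-filter⁺; ∈-filter⁻; ∈-allFin; ∈-lookup; ∈-++⁻; ∈-map⁺; ∈-map⁻; ∈-concatMap⁺; ∈-cartesianProduct⁺)
open import Data.List.Relation.Binary.Subset.Propositional using (_⊆_)
open import Data.List.Relation.Unary.All as All using (All; []; _∷_)
import Data.List.Relation.Unary.All.Properties as All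
open import Data.List.Relation.Unary.Any as Any using (here; there; index)
open import Data.List.Relation.Unary.Any.Properties using (lookup-index)
open import Data.List.Relation.Unary.Linked using ([-]; _∷_)
open import Data.List.Relation.Unary.Unique.Propositional using (Unique; []; _∷_)
import Data.List.Relation.Unary.Unique.Propositional.Properties as Unique
open import Data.Nat.Base as ℕ
  using (ℕ; zero; suc; _≤_; _<_; _∸_; _⊔_; _^_; _!; z≤n; s≤s; ⌊_/2⌋; ⌈_/2⌉)
import Data.Nat.Properties as ℕ
open import Data.Nat.Solver using (module +-*-Solver)
open import Data.Product.Base using (_×_; ∃-syntax; _,_; proj₁; proj₂)
open import Data.Rational.Base as ℚ using (ℚ; 0ℚ; 1ℚ; ½; _+_; _*_; _/_)
import Data.Rational.Properties as ℚ
import Data.Rational.Solver as ℚSolver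
import Data.Rational.Unnormalised.Base as ℚᵘ
import Data.Rational.Unnormalised.Properties as ℚᵘ
open import Data.Sum.Base as Sum using (_⊎_; inj₁; inj₂; [_,_]′)
open import Function.Bundles using (mk⇔; mk↔ₛ′)
open import Relation.Binary.Construct.Closure.ReflexiveTransitive as Star using (Star; _◅_; _◅◅_)
open import Relation.Binary.PropositionalEquality
open import Relation.Nullary.Decidable using (Dec; yes; no; ¬?; _×-dec_; toWitness)
open import Relation.Nullary.Negation.Core using (¬_; contradiction)

-- Partial sums of the exponential series

-- For `_<ℝ_` one positive rational must separate the partial sums from some index on, so every
-- inequality between powers of e is proved for `expSum` at a common index with ⅛ to spare.
-- Truncation is the obstacle: part of the product of the truncated series of e^k and e lies beyond
-- the truncation index, so the termwise estimate only gives (5/2) S_k(m) ≤ S_{k+1}(m + 2), where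
-- S_k is `expSum k` and 5/2 = 1 + 1 + 1/2 is the start of the series of e. Applied twice it yields
-- 25/4 = 6 + ¼, and the surplus ¼ both moves the index back to m and leaves the gap. The factor 6
-- is dictated by X = 2, Y = 3, where XY = 6 must stay below e²; from there on one doubling per unit
-- of X suffices. Mantel's bound takes the place of the exact edge count n - 1, because it follows
-- from the absence of triangles and a vertex of maximum degree, with no induction over trees.

private variable
  A B : Set

module ℚ× = Mult (CommutativeRing.semiring ℚ.+-*-commutativeRing)

-- Multiples of 1 instead of `+ n / 1`, so that `ι (suc n)` unfolds to `1ℚ + ι n` in inductions on
-- list lengths.
ι : ℕ → ℚ
ι n = n ℚ×.× 1ℚ

0≤ι : ∀ n → 0ℚ ℚ.≤ ι n
0≤ι zero    = ℚ.≤-refl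
0≤ι (suc n) = ℚ.+-mono-≤ {0ℚ} {1ℚ} (ℚ.<⇒≤ (ℚ.positive⁻¹ 1ℚ)) (0≤ι n)

ι-mono : ∀ {m n} → m ≤ n → ι m ℚ.≤ ι n
ι-mono {n = n} z≤n = 0≤ι n
ι-mono (s≤s m≤n)   = ℚ.+-monoʳ-≤ 1ℚ (ι-mono m≤n)

*-monoʳ-≤ : ∀ {p q r} → 0ℚ ℚ.≤ p → q ℚ.≤ r → p * q ℚ.≤ p * r
*-monoʳ-≤ {p} 0≤p = ℚ.*-monoˡ-≤-nonNeg p ⦃ ℚ.nonNegative 0≤p ⦄

*-monoˡ-≤ : ∀ {p q r} → 0ℚ ℚ.≤ p → q ℚ.≤ r → q * p ℚ.≤ r * p
*-monoˡ-≤ {p} 0≤p = ℚ.*-monoʳ-≤-nonNeg p ⦃ ℚ.nonNegative 0≤p ⦄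

p≤p+q : ∀ {p q} → 0ℚ ℚ.≤ q → p ℚ.≤ p + q
p≤p+q {p} {q} 0≤q = subst (ℚ._≤ p + q) (ℚ.+-identityʳ p) (ℚ.+-monoʳ-≤ p 0≤q)

Eventually : (ℕ → Set) → Set
Eventually P = ∃[ N ] (∀ m → N ≤ m → P m)

eventually-zip : ∀ {P Q R : ℕ → Set} → (∀ m → P m → Q m → R m) →
                 Eventually P → Eventually Q → Eventually R
eventually-zip f (M , p) (N , q) = M ⊔ N , λ m h →
  f m (p m (ℕ.m⊔n≤o⇒m≤o M N h)) (q m (ℕ.m⊔n≤o⇒n≤o M N h))

eventually-map : ∀ {P Q : ℕ → Set} → (∀ m → P m → Q m) → Eventually P → Eventually Q
eventually-map f (N , p) = N , λ m h → f m (p m h)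

-- Growth of the partial sums with the exponent

/-+ : ∀ a b d .⦃ _ : ℕ.NonZero d ⦄ → + a / d + + b / d ≡ + (a ℕ.+ b) / d
/-+ a b d@(suc _) = ℚ.toℚᵘ-injective (begin
  ℚ.toℚᵘ (+ a / d + + b / d)                 ≈⟨ ℚ.toℚᵘ-homo-+ (+ a / d) (+ b / d) ⟩
  ℚ.toℚᵘ (+ a / d) ℚᵘ.+ ℚ.toℚᵘ (+ b / d)     ≈⟨ ℚᵘ.+-cong (/-≃ a d) (/-≃ b d) ⟩
  (+ a ℚᵘ./ d) ℚᵘ.+ (+ b ℚᵘ./ d)             ≈⟨ ℚᵘ.*≡* numerators ⟩
  + (a ℕ.+ b) ℚᵘ./ d                         ≈⟨ /-≃ (a ℕ.+ b) d ⟨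
  ℚ.toℚᵘ (+ (a ℕ.+ b) / d)                   ∎)
  where
  open ℚᵘ.≃-Reasoning
  numerators : (+ a ℤ.* + d ℤ.+ + b ℤ.* + d) ℤ.* + d ≡ + (a ℕ.+ b) ℤ.* + (d ℕ.* d)
  numerators = trans
    (cong (ℤ._* + d) (sym (ℤ.*-distribʳ-+ (+ d) (+ a) (+ b))))
    (trans (ℤ.*-assoc (+ (a ℕ.+ b)) (+ d) (+ d))
           (cong (+ (a ℕ.+ b) ℤ.*_) (sym (ℤ.pos-* d d))))

-- The first three binomial terms of (k + 1)^(i + 2), doubled to clear the denominator of the third.
-- In the induction, `suc k` times the left side for i exceeds the left side for i + 1 by (i + 2)(i
-- + 1)k^i.
binomial-bound : ∀ k i →
  (2 ℕ.* k ^ (2 ℕ.+ i) ℕ.+ 2 ℕ.* ((2 ℕ.+ i) ℕ.* k ^ suc i)) ℕ.+ (2 ℕ.+ i) ℕ.* (suc i ℕ.* k ^ i)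
  ≤ 2 ℕ.* suc k ^ (2 ℕ.+ i)
binomial-bound k zero = ℕ.≤-reflexive (solve 1 (λ k →
  (con 2 :* (k :* (k :* con 1)) :+ con 2 :* (con 2 :* (k :* con 1))) :+ con 2 :* (con 1 :* con 1)
  := con 2 :* ((con 1 :+ k) :* ((con 1 :+ k) :* con 1))) refl k)
  where open +-*-Solver
binomial-bound k (suc i) = begin
  lhs                                 ≤⟨ ℕ.m≤m+n lhs _ ⟩
  lhs ℕ.+ (2 ℕ.+ i) ℕ.* (suc i ℕ.* p) ≡⟨ expand k i p ⟩
  suc k ℕ.* ((2 ℕ.* (k ℕ.* (k ℕ.* p)) ℕ.+ 2 ℕ.* ((2 ℕ.+ i) ℕ.* (k ℕ.* p))) ℕ.+ (2 ℕ.+ i) ℕ.* (suc i ℕ.* p))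
                                      ≤⟨ ℕ.*-monoʳ-≤ (suc k) (binomial-bound k i) ⟩
  suc k ℕ.* (2 ℕ.* suc k ^ (2 ℕ.+ i)) ≡⟨ swap (suc k) (suc k ^ (2 ℕ.+ i)) ⟩
  2 ℕ.* suc k ^ (3 ℕ.+ i)             ∎
  where
  open ℕ.≤-Reasoning
  open +-*-Solver
  p = k ^ i
  lhs = (2 ℕ.* k ^ (3 ℕ.+ i) ℕ.+ 2 ℕ.* ((3 ℕ.+ i) ℕ.* k ^ (2 ℕ.+ i))) ℕ.+ (3 ℕ.+ i) ℕ.* ((2 ℕ.+ i) ℕ.* k ^ suc i)
  swap : ∀ a b → a ℕ.* (2 ℕ.* b) ≡ 2 ℕ.* (a ℕ.* b)
  swap = solve 2 (λ a b → a :* (con 2 :* b) := con 2 :* (a :* b)) refl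
  expand : ∀ k i p →
    ((2 ℕ.* (k ℕ.* (k ℕ.* (k ℕ.* p))) ℕ.+ 2 ℕ.* ((3 ℕ.+ i) ℕ.* (k ℕ.* (k ℕ.* p)))) ℕ.+ (3 ℕ.+ i) ℕ.* ((2 ℕ.+ i) ℕ.* (k ℕ.* p)))
      ℕ.+ (2 ℕ.+ i) ℕ.* (suc i ℕ.* p)
    ≡ suc k ℕ.* ((2 ℕ.* (k ℕ.* (k ℕ.* p)) ℕ.+ 2 ℕ.* ((2 ℕ.+ i) ℕ.* (k ℕ.* p))) ℕ.+ (2 ℕ.+ i) ℕ.* (suc i ℕ.* p))
  expand = solve 3 (λ k i p →
    ((con 2 :* (k :* (k :* (k :* p))) :+ con 2 :* ((con 3 :+ i) :* (k :* (k :* p)))) :+ (con 3 :+ i) :* ((con 2 :+ i) :* (k :* p)))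
      :+ (con 2 :+ i) :* ((con 1 :+ i) :* p)
    := (con 1 :+ k) :* ((con 2 :* (k :* (k :* p)) :+ con 2 :* ((con 2 :+ i) :* (k :* p))) :+ (con 2 :+ i) :* ((con 1 :+ i) :* p))) refl

expTerm-suc : ∀ k i → expTerm k i ≡ _/_ (+ (suc i ℕ.* k ^ i)) (suc i !) ⦃ suc i ℕ.!≢0 ⦄
expTerm-suc k i = ℚ.≤-antisym
  (/-≤ (k ^ i) (i !) (suc i ℕ.* k ^ i) (suc i !) ⦃ i ℕ.!≢0 ⦄ ⦃ suc i ℕ.!≢0 ⦄ (ℕ.≤-reflexive (eq (k ^ i) i (i !))))
  (/-≤ (suc i ℕ.* k ^ i) (suc i !) (k ^ i) (i !) ⦃ suc i ℕ.!≢0 ⦄ ⦃ i ℕ.!≢0 ⦄ (ℕ.≤-reflexive (sym (eq (k ^ i) i (i !)))))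
  where
  open +-*-Solver
  eq : ∀ p i f → p ℕ.* (suc i ℕ.* f) ≡ suc i ℕ.* p ℕ.* f
  eq = solve 3 (λ p i f → p :* ((con 1 :+ i) :* f) := (con 1 :+ i) :* p :* f) refl

expTerm-suc² : ∀ k i → expTerm k i ≡ _/_ (+ ((2 ℕ.+ i) ℕ.* (suc i ℕ.* k ^ i))) ((2 ℕ.+ i) !) ⦃ (2 ℕ.+ i) ℕ.!≢0 ⦄
expTerm-suc² k i = trans (expTerm-suc k i) (ℚ.≤-antisym
  (/-≤ p (suc i !) (s ℕ.* p) (s !) ⦃ suc i ℕ.!≢0 ⦄ ⦃ s ℕ.!≢0 ⦄ (ℕ.≤-reflexive (eq p s (suc i !))))
  (/-≤ (s ℕ.* p) (s !) p (suc i !) ⦃ s ℕ.!≢0 ⦄ ⦃ suc i ℕ.!≢0 ⦄ (ℕ.≤-reflexive (sym (eq p s (suc i !))))))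
  where
  open +-*-Solver
  s = 2 ℕ.+ i
  p = suc i ℕ.* k ^ i
  eq : ∀ p s f → p ℕ.* (s ℕ.* f) ≡ s ℕ.* p ℕ.* f
  eq = solve 3 (λ p s f → p :* (s :* f) := s :* p :* f) refl

-- The first three terms of the Cauchy product of e^k and e.
expTerm-step : ∀ k i →
  ((expTerm k (2 ℕ.+ i) + expTerm k (2 ℕ.+ i)) + (expTerm k (suc i) + expTerm k (suc i))) + expTerm k i
  ℚ.≤ expTerm (suc k) (2 ℕ.+ i) + expTerm (suc k) (2 ℕ.+ i)
expTerm-step k i = begin
  ((expTerm k (2 ℕ.+ i) + expTerm k (2 ℕ.+ i)) + (expTerm k (suc i) + expTerm k (suc i))) + expTerm k i
    ≡⟨ cong₂ _+_ (cong₂ _+_ (/-double (k ^ s) (s !))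
                             (trans (cong (λ t → t + t) (expTerm-suc k (suc i))) (/-double (s ℕ.* k ^ suc i) (s !))))
                 (expTerm-suc² k i) ⟩
  (+ (2 ℕ.* k ^ s) / s ! + + (2 ℕ.* (s ℕ.* k ^ suc i)) / s !) + + (s ℕ.* (suc i ℕ.* k ^ i)) / s !
    ≡⟨ cong (_+ + (s ℕ.* (suc i ℕ.* k ^ i)) / s !) (/-+ (2 ℕ.* k ^ s) _ (s !)) ⟩
  + (2 ℕ.* k ^ s ℕ.+ 2 ℕ.* (s ℕ.* k ^ suc i)) / s ! + + (s ℕ.* (suc i ℕ.* k ^ i)) / s !
    ≡⟨ /-+ (2 ℕ.* k ^ s ℕ.+ 2 ℕ.* (s ℕ.* k ^ suc i)) _ (s !) ⟩
  + ((2 ℕ.* k ^ s ℕ.+ 2 ℕ.* (s ℕ.* k ^ suc i)) ℕ.+ s ℕ.* (suc i ℕ.* k ^ i)) / s !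
    ≤⟨ /-≤ ((2 ℕ.* k ^ s ℕ.+ 2 ℕ.* (s ℕ.* k ^ suc i)) ℕ.+ s ℕ.* (suc i ℕ.* k ^ i)) (s !) (2 ℕ.* suc k ^ s) (s !) (ℕ.*-monoˡ-≤ (s !) (binomial-bound k i)) ⟩
  + (2 ℕ.* suc k ^ s) / s !
    ≡⟨ /-double (suc k ^ s) (s !) ⟨
  expTerm (suc k) s + expTerm (suc k) s ∎
  where
  open ℚ.≤-Reasoning
  s = 2 ℕ.+ i
  instance
    s!≢0 : ℕ.NonZero (s !)
    s!≢0 = s ℕ.!≢0

-- `expTerm-step` summed over the index. The terms of degrees 0 and 1, which it does not reach, form
-- the base case, an equality.
expSum-step : ∀ k m →
  ((expSum k (2 ℕ.+ m) + expSum k (2 ℕ.+ m)) + (expSum k (suc m) + expSum k (suc m))) + expSum k m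
  ℚ.≤ expSum (suc k) (2 ℕ.+ m) + expSum (suc k) (2 ℕ.+ m)
expSum-step k zero = ℚ.≤-reflexive (begin
  (((0ℚ + 1ℚ + a) + (0ℚ + 1ℚ + a)) + ((0ℚ + 1ℚ) + (0ℚ + 1ℚ))) + 0ℚ
    ≡⟨ solve 1 (λ a → (((con 0ℚ :+ con 1ℚ :+ a) :+ (con 0ℚ :+ con 1ℚ :+ a)) :+ ((con 0ℚ :+ con 1ℚ) :+ (con 0ℚ :+ con 1ℚ))) :+ con 0ℚ
        := (con 0ℚ :+ con 1ℚ :+ (con 1ℚ :+ a)) :+ (con 0ℚ :+ con 1ℚ :+ (con 1ℚ :+ a))) refl a ⟩
  (0ℚ + 1ℚ + (1ℚ + a)) + (0ℚ + 1ℚ + (1ℚ + a))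
    ≡⟨ cong (λ b → (0ℚ + 1ℚ + b) + (0ℚ + 1ℚ + b)) (/-+ 1 (k ^ 1) 1) ⟩
  (0ℚ + 1ℚ + expTerm (suc k) 1) + (0ℚ + 1ℚ + expTerm (suc k) 1) ∎)
  where
  open ≡-Reasoning
  open ℚSolver.+-*-Solver
  a = expTerm k 1
expSum-step k (suc m) = begin
  (((S₂ + t₂) + (S₂ + t₂)) + ((S₁ + t₁) + (S₁ + t₁))) + (S₀ + t₀)
    ≡⟨ regroup S₂ S₁ S₀ t₂ t₁ t₀ ⟩
  (((S₂ + S₂) + (S₁ + S₁)) + S₀) + (((t₂ + t₂) + (t₁ + t₁)) + t₀)
    ≤⟨ ℚ.+-mono-≤ (expSum-step k m) (expTerm-step k m) ⟩
  (S′ + S′) + (t′ + t′)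
    ≡⟨ solve 2 (λ s t → (s :+ s) :+ (t :+ t) := (s :+ t) :+ (s :+ t)) refl S′ t′ ⟩
  (S′ + t′) + (S′ + t′) ∎
  where
  open ℚ.≤-Reasoning
  open ℚSolver.+-*-Solver
  S₂ = expSum k (2 ℕ.+ m)
  S₁ = expSum k (suc m)
  S₀ = expSum k m
  t₂ = expTerm k (2 ℕ.+ m)
  t₁ = expTerm k (suc m)
  t₀ = expTerm k m
  S′ = expSum (suc k) (2 ℕ.+ m)
  t′ = expTerm (suc k) (2 ℕ.+ m)
  regroup : ∀ a b c x y z → (((a + x) + (a + x)) + ((b + y) + (b + y))) + (c + z)
            ≡ (((a + a) + (b + b)) + c) + (((x + x) + (y + y)) + z)
  regroup = solve 6 (λ a b c x y z → (((a :+ x) :+ (a :+ x)) :+ ((b :+ y) :+ (b :+ y))) :+ (c :+ z)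
            := (((a :+ a) :+ (b :+ b)) :+ c) :+ (((x :+ x) :+ (y :+ y)) :+ z)) refl

0≤expSum : ∀ k m → 0ℚ ℚ.≤ expSum k m
0≤expSum k m = subst (λ i → 0ℚ ℚ.≤ expSum k i) (ℕ.+-identityʳ m) (expSum-mono k 0 m)

1≤expSum : ∀ k m → 1 ≤ m → 1ℚ ℚ.≤ expSum k m
1≤expSum k (suc m) _ = subst (λ i → 1ℚ ℚ.≤ expSum k i) (ℕ.+-comm m 1) (expSum-mono k 1 m)

-- Lowering all sums on the left of `expSum-step` to `expSum k m` leaves 2 + 2 + 1 copies of it
-- against two on the right.
expSum-shift₁ : ∀ k m → + 5 / 2 * expSum k m ℚ.≤ expSum (suc k) (2 ℕ.+ m)
expSum-shift₁ k m = begin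
  + 5 / 2 * S           ≡⟨ solve 1 (λ s → con (+ 5 / 2) :* s := con ½ :* (((s :+ s) :+ (s :+ s)) :+ s)) refl S ⟩
  ½ * (((S + S) + (S + S)) + S)
                        ≤⟨ *-monoʳ-≤ (ℚ.nonNegative⁻¹ ½) (ℚ.+-monoˡ-≤ S (ℚ.+-mono-≤ (ℚ.+-mono-≤ two two) (ℚ.+-mono-≤ one one))) ⟩
  ½ * (((S₂ + S₂) + (S₁ + S₁)) + S)
                        ≤⟨ *-monoʳ-≤ (ℚ.nonNegative⁻¹ ½) (expSum-step k m) ⟩
  ½ * (S′ + S′)         ≡⟨ solve 1 (λ s → con ½ :* (s :+ s) := s) refl S′ ⟩
  S′                    ∎
  where
  open ℚ.≤-Reasoning
  open ℚSolver.+-*-Solver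
  S = expSum k m
  S₁ = expSum k (suc m)
  S₂ = expSum k (2 ℕ.+ m)
  S′ = expSum (suc k) (2 ℕ.+ m)
  one = expSum-mono k m 1
  two = expSum-mono k m 2

expSum-shift₂ : ∀ k m → + 25 / 4 * expSum k m ℚ.≤ expSum (2 ℕ.+ k) (4 ℕ.+ m)
expSum-shift₂ k m = begin
  + 25 / 4 * S                       ≡⟨ ℚ.*-assoc (+ 5 / 2) (+ 5 / 2) S ⟩
  + 5 / 2 * (+ 5 / 2 * S)            ≤⟨ *-monoʳ-≤ (ℚ.nonNegative⁻¹ (+ 5 / 2)) (expSum-shift₁ k m) ⟩
  + 5 / 2 * expSum (suc k) (2 ℕ.+ m) ≤⟨ expSum-shift₁ (suc k) (2 ℕ.+ m) ⟩
  expSum (2 ℕ.+ k) (4 ℕ.+ m)         ∎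
  where
  open ℚ.≤-Reasoning
  S = expSum k m

⅛ ¼ : ℚ
⅛ = + 1 / 8
¼ = + 1 / 4

-- A quarter of expSum pays for the index shift, whose effect on expSum k is
-- bounded by the tail.
absorb-shift : ∀ k (F : ℕ → ℚ) s {p ε} → 0ℚ ℚ.≤ p → 0ℚ ℚ.< ε → p * ε ℚ.≤ ⅛ →
               (∀ m → (p + ¼) * expSum k m ℚ.≤ F (s ℕ.+ m)) →
               Eventually (λ m → p * expSum k m + ⅛ ℚ.≤ F m)
-- `suc N` rather than `N` keeps the index positive, as `1≤expSum` requires; adding `s` lets it be
-- split as `s + (m ∸ s)`.
absorb-shift k F s {p} {ε} 0≤p 0<ε pε≤⅛ shift = s ℕ.+ suc N , λ m h →
  subst (λ m → p * expSum k m + ⅛ ℚ.≤ F m) (ℕ.m+[n∸m]≡n (ℕ.m+n≤o⇒m≤o s h))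
        (bound (m ℕ.∸ s) (subst (_≤ m ℕ.∸ s) (ℕ.m+n∸m≡n s (suc N)) (ℕ.∸-monoˡ-≤ s h)))
  where
  open ℚ.≤-Reasoning
  open ℚSolver.+-*-Solver
  tail = expTail-small k 0<ε
  N = proj₁ tail
  small = proj₂ (proj₂ tail)
  bounds = expSum-bounds k N (proj₁ (proj₂ tail))
  bound : ∀ m → suc N ≤ m → p * expSum k (s ℕ.+ m) + ⅛ ℚ.≤ F (s ℕ.+ m)
  bound m N<m = begin
    p * expSum k (s ℕ.+ m) + ⅛
      ≤⟨ ℚ.+-monoˡ-≤ ⅛ (*-monoʳ-≤ 0≤p (proj₂ (bounds (s ℕ.+ m) (ℕ.≤-trans N≤m (ℕ.m≤n+m m s))))) ⟩
    p * (expSum k N + expTail k N) + ⅛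
      ≤⟨ ℚ.+-monoˡ-≤ ⅛ (*-monoʳ-≤ 0≤p (ℚ.+-mono-≤ (proj₁ (bounds m N≤m)) (ℚ.<⇒≤ small))) ⟩
    p * (S + ε) + ⅛     ≡⟨ cong (_+ ⅛) (ℚ.*-distribˡ-+ p S ε) ⟩
    (p * S + p * ε) + ⅛ ≤⟨ ℚ.+-monoˡ-≤ ⅛ (ℚ.+-monoʳ-≤ (p * S) pε≤⅛) ⟩
    (p * S + ⅛) + ⅛     ≡⟨ solve 1 (λ x → (x :+ con ⅛) :+ con ⅛ := x :+ con ¼ :* con 1ℚ) refl (p * S) ⟩
    -- The quarter covers both eighths, the price of the shift and the gap, since `S` is at least
    -- its first term 1.
    p * S + ¼ * 1ℚ      ≤⟨ ℚ.+-monoʳ-≤ (p * S) (*-monoʳ-≤ (ℚ.nonNegative⁻¹ ¼) (1≤expSum k m (ℕ.≤-trans (s≤s z≤n) N<m))) ⟩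
    p * S + ¼ * S       ≡⟨ ℚ.*-distribʳ-+ S p ¼ ⟨
    (p + ¼) * S         ≤⟨ shift m ⟩
    F (s ℕ.+ m)         ∎
    where
    N≤m = ℕ.<⇒≤ N<m
    S = expSum k m

-- The largest tail with 6ε ≤ ⅛; it serves the factor 2 as well.
ε₀ : ℚ
ε₀ = + 1 / 48

expSum-double : ∀ k → Eventually (λ m → ι 2 * expSum k m + ⅛ ℚ.≤ expSum (suc k) m)
expSum-double k = absorb-shift k (expSum (suc k)) 2 (0≤ι 2) (ℚ.positive⁻¹ ε₀) (toWitness {a? = ι 2 * ε₀ ℚ.≤? ⅛} _)
  (λ m → ℚ.≤-trans (*-monoˡ-≤ (0≤expSum k m) (toWitness {a? = ι 2 + ¼ ℚ.≤? + 5 / 2} _)) (expSum-shift₁ k m))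

expSum-sextuple : ∀ k → Eventually (λ m → ι 6 * expSum k m + ⅛ ℚ.≤ expSum (2 ℕ.+ k) m)
expSum-sextuple k = absorb-shift k (expSum (2 ℕ.+ k)) 4 (0≤ι 6) (ℚ.positive⁻¹ ε₀) (toWitness {a? = ι 6 * ε₀ ℚ.≤? ⅛} _)
  -- `ι 6 + ¼` evaluates to 25/4.
  (λ m → expSum-shift₂ k m)

-- The factor 6 uses up two units of the exponent, each factor 2 one more. Every doubling drops the
-- eighth it receives and gains a new one.
expSum-grow : ∀ k j → Eventually (λ m → ι (2 ^ j ℕ.* 6) * expSum k m + ⅛ ℚ.≤ expSum (j ℕ.+ (2 ℕ.+ k)) m)
expSum-grow k zero    = expSum-sextuple k
expSum-grow k (suc j) = eventually-zip step (expSum-grow k j) (expSum-double (j ℕ.+ (2 ℕ.+ k)))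
  where
  open ℚ.≤-Reasoning
  c = 2 ^ j ℕ.* 6
  step : ∀ m → ι c * expSum k m + ⅛ ℚ.≤ expSum (j ℕ.+ (2 ℕ.+ k)) m →
         ι 2 * expSum (j ℕ.+ (2 ℕ.+ k)) m + ⅛ ℚ.≤ expSum (suc j ℕ.+ (2 ℕ.+ k)) m →
         ι (2 ℕ.* 2 ^ j ℕ.* 6) * expSum k m + ⅛ ℚ.≤ expSum (suc j ℕ.+ (2 ℕ.+ k)) m
  step m h₁ h₂ = begin
    ι (2 ℕ.* 2 ^ j ℕ.* 6) * S + ⅛  ≡⟨ cong (λ n → ι n * S + ⅛) (ℕ.*-assoc 2 (2 ^ j) 6) ⟩
    ι (2 ℕ.* c) * S + ⅛   ≡⟨ cong (λ x → x * S + ⅛) (ℚ×.×1-homo-* 2 c) ⟩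
    ι 2 * ι c * S + ⅛     ≡⟨ cong (_+ ⅛) (ℚ.*-assoc (ι 2) (ι c) S) ⟩
    ι 2 * (ι c * S) + ⅛   ≤⟨ ℚ.+-monoˡ-≤ ⅛ (*-monoʳ-≤ {ι 2} {ι c * S} (0≤ι 2) (ℚ.≤-trans (p≤p+q {ι c * S} (ℚ.nonNegative⁻¹ ⅛)) h₁)) ⟩
    ι 2 * expSum (j ℕ.+ (2 ℕ.+ k)) m + ⅛  ≤⟨ h₂ ⟩
    expSum (suc j ℕ.+ (2 ℕ.+ k)) m ∎
    where S = expSum k m

expSum-dominates : ∀ N k j → N ≤ 2 ^ j ℕ.* 6 →
                   Eventually (λ m → ι N * expSum k m + ⅛ ℚ.≤ expSum (j ℕ.+ (2 ℕ.+ k)) m)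
expSum-dominates N k j h = eventually-map
  (λ m → ℚ.≤-trans (ℚ.+-monoˡ-≤ ⅛ (*-monoˡ-≤ (0≤expSum k m) (ι-mono h))))
  (expSum-grow k j)

expSum-monoˡ : ∀ {k l} m → k ≤ l → expSum k m ℚ.≤ expSum l m
expSum-monoˡ zero    k≤l = ℚ.≤-refl
expSum-monoˡ {k} {l} (suc m) k≤l = ℚ.+-mono-≤ (expSum-monoˡ m k≤l)
  (/-≤ (k ^ m) (m !) (l ^ m) (m !) ⦃ m ℕ.!≢0 ⦄ ⦃ m ℕ.!≢0 ⦄ (ℕ.*-monoˡ-≤ (m !) (ℕ.^-monoˡ-≤ m k≤l)))

-- Bounds on finite sums of reals

sum≤ : ∀ (f : A → ℝ) {b} m xs → (∀ {x} → x ∈ xs → seq (f x) m ℚ.≤ b) →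
       seq (sumℝ (map f xs)) m ℚ.≤ ι (length xs) * b
sum≤ f {b} m []       h = ℚ.≤-reflexive (sym (ℚ.*-zeroˡ b))
sum≤ f {b} m (x ∷ xs) h = begin
  seq (f x) m + seq (sumℝ (map f xs)) m ≤⟨ ℚ.+-mono-≤ (h (here refl)) (sum≤ f m xs (λ i → h (there i))) ⟩
  b + ι (length xs) * b                 ≡⟨ solve 2 (λ b l → b :+ l :* b := (con 1ℚ :+ l) :* b) refl b (ι (length xs)) ⟩
  ι (length (x ∷ xs)) * b               ∎
  where
  open ℚ.≤-Reasoning
  open ℚSolver.+-*-Solver

0≤sum : ∀ (f : A → ℝ) m xs → (∀ x → 0ℚ ℚ.≤ seq (f x) m) → 0ℚ ℚ.≤ seq (sumℝ (map f xs)) m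
0≤sum f m []       0≤f = ℚ.≤-refl
0≤sum f m (x ∷ xs) 0≤f = ℚ.+-mono-≤ {0ℚ} (0≤f x) (0≤sum f m xs 0≤f)

≤sum : ∀ (f : A → ℝ) m {x xs} → (∀ x → 0ℚ ℚ.≤ seq (f x) m) → x ∈ xs →
       seq (f x) m ℚ.≤ seq (sumℝ (map f xs)) m
≤sum f m {xs = _ ∷ xs} 0≤f (here refl) = p≤p+q (0≤sum f m xs 0≤f)
≤sum f m {x} {y ∷ xs}  0≤f (there i)   =
  subst (ℚ._≤ _) (ℚ.+-identityˡ (seq (f x) m)) (ℚ.+-mono-≤ {0ℚ} (0≤f y) (≤sum f m 0≤f i))

-- Uniqueness keeps `x₀` out of the remaining entries. The exceptional entry stays included in
-- `length xs`, at the price of `0≤b`, so that a bound on the edge count can be inserted directly.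
sum≤-except : ∀ (f : A → ℝ) {b} m {x₀ xs} → 0ℚ ℚ.≤ b → Unique xs →
              (∀ {x} → x ∈ xs → x ≢ x₀ → seq (f x) m ℚ.≤ b) → x₀ ∈ xs →
              seq (sumℝ (map f xs)) m ℚ.≤ seq (f x₀) m + ι (length xs) * b
sum≤-except f {b} m {x₀} {_ ∷ xs} 0≤b (x₀∉ ∷ _) h (here refl) = ℚ.+-monoʳ-≤ (seq (f x₀) m) (ℚ.≤-trans
  (sum≤ f m xs (λ i → h (there i) (λ eq → All.lookup x₀∉ i (sym eq))))
  (*-monoˡ-≤ 0≤b (ι-mono (ℕ.n≤1+n (length xs)))))
sum≤-except f {b} m {x₀} {x ∷ xs} 0≤b (x∉ ∷ u) h (there i) = begin
  seq (f x) m + seq (sumℝ (map f xs)) m  ≤⟨ ℚ.+-mono-≤ (h (here refl) (All.lookup x∉ i))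
                                                       (sum≤-except f m 0≤b u (λ j → h (there j)) i) ⟩
  b + (s₀ + ι (length xs) * b)           ≡⟨ solve 3 (λ b s₀ l → b :+ (s₀ :+ l :* b) := s₀ :+ (con 1ℚ :+ l) :* b)
                                                    refl b s₀ (ι (length xs)) ⟩
  s₀ + ι (length (x ∷ xs)) * b           ∎
  where
  open ℚ.≤-Reasoning
  open ℚSolver.+-*-Solver
  s₀ = seq (f x₀) m

-- Graphs without triangles and squares

lookup-injective : ∀ {xs : List A} → Unique xs → ∀ i j → lookup xs i ≡ lookup xs j → i ≡ j
lookup-injective {xs = _ ∷ _} _            zero    zero    _  = refl
lookup-injective (x∉xs ∷ _)     zero    (suc j) eq = contradiction eq (All.lookup x∉xs (∈-lookup j))
lookup-injective (x∉xs ∷ _)     (suc i) zero    eq = contradiction (sym eq) (All.lookup x∉xs (∈-lookup i))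
lookup-injective (_ ∷ unique)   (suc i) (suc j) eq = cong suc (lookup-injective unique i j eq)

length-⊆ : ∀ {xs ys : List A} → Unique xs → xs ⊆ ys → length xs ≤ length ys
length-⊆ {xs = xs} {ys} unique xs⊆ys = Fin.injective⇒≤ {f = position} injective
  where
  position : Fin (length xs) → Fin (length ys)
  position i = index (xs⊆ys (∈-lookup i))
  injective : ∀ {i j} → position i ≡ position j → i ≡ j
  injective {i} {j} eq = lookup-injective unique i j (begin
    lookup xs i            ≡⟨ lookup-index (xs⊆ys (∈-lookup i)) ⟩
    lookup ys (position i) ≡⟨ cong (lookup ys) eq ⟩
    lookup ys (position j) ≡⟨ lookup-index (xs⊆ys (∈-lookup j)) ⟨
    lookup xs j            ∎)
    where open ≡-Reasoning

length-allFin : ∀ n → length (allFin n) ≡ n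
length-allFin n = List.length-tabulate {n = n} (λ i → i)

length-unique : ∀ {n} {xs : List (Fin n)} → Unique xs → length xs ≤ n
length-unique {n} {xs} unique = subst (length xs ≤_) (length-allFin n) (length-⊆ unique (λ _ → ∈-allFin _))

length-concatMap : ∀ (f : A → List B) {K} xs → (∀ x → length (f x) ≤ K) →
                   length (concatMap f xs) ≤ length xs ℕ.* K
length-concatMap f []       h = z≤n
length-concatMap f {K} (x ∷ xs) h = subst (_≤ K ℕ.+ length xs ℕ.* K) (sym (List.length-++ (f x)))
  (ℕ.+-mono-≤ (h x) (length-concatMap f xs h))

-- A missed `j` put in front of the image would give m + 1 > n distinct elements of `Fin n`.
injective⇒surjective : ∀ {m n} (f : Fin m → Fin n) → n ≤ m →
                       (∀ {i j} → f i ≡ f j → i ≡ j) → ∀ j → ∃[ i ] f i ≡ j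
injective⇒surjective {m} {n} f n≤m injective j with Fin.any? (λ i → f i Fin.≟ j)
... | yes found = found
... | no ¬found = contradiction (length-unique unique) (ℕ.<⇒≱ (s≤s (subst (n ≤_) (sym len) n≤m)))
  where
  image = map f (allFin m)
  len : length image ≡ m
  len = trans (List.length-map f (allFin m)) (length-allFin m)
  unique : Unique (j ∷ image)
  unique = All.tabulate (λ x∈ → λ { refl → let (i , _ , eq) = ∈-map⁻ f x∈ in ¬found (i , sym eq) })
         ∷ Unique.map⁺ injective (Unique.allFin⁺ m)

argmax : ∀ {n} → Fin n → (f : Fin n → ℕ) → ∃[ i ] (∀ j → f j ≤ f i)
argmax {suc zero}    _ f = zero , λ { zero → ℕ.≤-refl }
argmax {suc (suc n)} _ f with argmax zero (λ i → f (suc i))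
... | i , max with ℕ.≤-total (f zero) (f (suc i))
...   | inj₁ f0≤ = suc i , λ { zero → f0≤ ; (suc j) → max j }
...   | inj₂ ≤f0 = zero , λ { zero → ℕ.≤-refl ; (suc j) → ℕ.≤-trans (max j) ≤f0 }

-- Neighbourhoods and edges

module _ {n} (G : Graph n) where
  open Graph G

  neighbours : Fin n → List (Fin n)
  neighbours v = filter (v ~?_) (allFin n)

  ∈-neighbours⁺ : ∀ {v w} → v ~ w → w ∈ neighbours v
  ∈-neighbours⁺ {v} {w} = ∈-filter⁺ (v ~?_) (∈-allFin w)

  ∈-neighbours⁻ : ∀ {v w} → w ∈ neighbours v → v ~ w
  ∈-neighbours⁻ {v} w∈ = proj₂ (∈-filter⁻ (v ~?_) {xs = allFin n} w∈)

  neighbours-unique : ∀ v → Unique (neighbours v)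
  neighbours-unique v = Unique.filter⁺ (v ~?_) (Unique.allFin⁺ n)

  ~⇒≢ : ∀ {u v} → u ~ v → u ≢ v
  ~⇒≢ u~v u≡v = ~-irrefl u≡v u~v

  length≤degree : ∀ {v xs} → Unique xs → (∀ {w} → w ∈ xs → v ~ w) → length xs ≤ degree v
  length≤degree unique h = length-⊆ unique (λ w∈ → ∈-neighbours⁺ (h w∈))

  degree≤length : ∀ {v xs} → (∀ {w} → v ~ w → w ∈ xs) → degree v ≤ length xs
  degree≤length {v} h = length-⊆ (neighbours-unique v) (λ w∈ → h (∈-neighbours⁻ w∈))

  degree<n : ∀ v → degree v < n
  degree<n v = length-unique
    (All.tabulate (λ w∈ → ~⇒≢ (∈-neighbours⁻ w∈)) ∷ neighbours-unique v)

  ∈-edges⁻ : ∀ {u v} → (u , v) ∈ edges → u Fin.< v × u ~ v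
  ∈-edges⁻ uv∈ = proj₂ (∈-filter⁻ (λ (u , v) → (u Fin.<? v) ×-dec (u ~? v)) {xs = cartesianProduct (allFin n) (allFin n)} uv∈)

  ∈-edges⁺ : ∀ {u v} → u Fin.< v → u ~ v → (u , v) ∈ edges
  ∈-edges⁺ {u} {v} u<v u~v = ∈-filter⁺ (λ (u , v) → (u Fin.<? v) ×-dec (u ~? v))
    (∈-cartesianProduct⁺ (∈-allFin u) (∈-allFin v)) (u<v , u~v)

  edges-unique : Unique edges
  edges-unique = Unique.filter⁺ _ (Unique.cartesianProduct⁺ (Unique.allFin⁺ n) (Unique.allFin⁺ n))

  -- Contains `v` itself, by irreflexivity, so the edges at `v` are among those that `length-edges`
  -- covers.
  nonNeighbours : Fin n → List (Fin n)
  nonNeighbours v = filter (λ w → ¬? (v ~? w)) (allFin n)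

  ∈-nonNeighbours⁺ : ∀ {v w} → ¬ v ~ w → w ∈ nonNeighbours v
  ∈-nonNeighbours⁺ {v} {w} = ∈-filter⁺ (λ w → ¬? (v ~? w)) (∈-allFin w)

  degree+nonNeighbours : ∀ v → degree v ℕ.+ length (nonNeighbours v) ≤ n
  degree+nonNeighbours v = subst (_≤ n) (List.length-++ (neighbours v)) (length-unique
    (Unique.++⁺ (neighbours-unique v) (Unique.filter⁺ _ (Unique.allFin⁺ n))
      (λ (p , q) → proj₂ (∈-filter⁻ (λ w → ¬? (v ~? w)) {xs = allFin n} q) (∈-neighbours⁻ p))))

  -- Restores the orientation used by `edges`, whichever end an edge is reached from.
  edge : Fin n → Fin n → Fin n × Fin n
  edge u v with u Fin.<? v
  ... | yes _ = u , v
  ... | no  _ = v , u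

  edge-< : ∀ {u v} → u Fin.< v → edge u v ≡ (u , v) × edge v u ≡ (u , v)
  edge-< {u} {v} u<v = lemma₁ , lemma₂
    where
    lemma₁ : edge u v ≡ (u , v)
    lemma₁ with u Fin.<? v
    ... | yes _ = refl
    ... | no u≮v = contradiction u<v u≮v
    lemma₂ : edge v u ≡ (u , v)
    lemma₂ with v Fin.<? u
    ... | yes v<u = contradiction v<u (Fin.<-asym u<v)
    ... | no _ = refl

  -- Without triangles the neighbours of v are independent, so every edge has
  -- an endpoint outside them.
  length-edges : (∀ {u v w} → u ~ v → v ~ w → w ~ u → ⊥) →
                 ∀ v → (∀ w → degree w ≤ degree v) →
                 length edges ≤ length (nonNeighbours v) ℕ.* degree v
  length-edges no-triangle v max = ℕ.≤-trans
    (length-⊆ edges-unique (λ { {p , q} → covered p q }))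
    (length-concatMap star (nonNeighbours v) (λ w →
      subst (_≤ degree v) (sym (List.length-map (edge w) (neighbours w))) (max w)))
    where
    star : Fin n → List (Fin n × Fin n)
    star w = map (edge w) (neighbours w)
    covered : ∀ p q → (p , q) ∈ edges → (p , q) ∈ concatMap star (nonNeighbours v)
    covered p q pq∈ with v ~? p | ∈-edges⁻ pq∈
    ... | no v≁p | p<q , p~q = ∈-concatMap⁺ star (Any.map
      (λ { refl → subst (_∈ star p) (proj₁ (edge-< p<q)) (∈-map⁺ (edge p) (∈-neighbours⁺ p~q)) }) (∈-nonNeighbours⁺ v≁p))
    ... | yes v~p | p<q , p~q = ∈-concatMap⁺ star (Any.map
      (λ { refl → subst (_∈ star q) (proj₂ (edge-< p<q)) (∈-map⁺ (edge q) (∈-neighbours⁺ (~-sym p~q))) })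
      (∈-nonNeighbours⁺ (λ v~q → no-triangle v~p p~q (~-sym v~q))))

  module AcyclicGraph (acyclic : Acyclic) where

    no-triangle : ∀ {u v w} → u ~ v → v ~ w → w ~ u → ⊥
    no-triangle {u} {v} {w} u~v v~w w~u = acyclic record
      { start    = u
      ; rest     = v ∷ w ∷ []
      ; long     = ℕ.≤-refl
      ; distinct = (~⇒≢ u~v ∷ ≢-sym (~⇒≢ w~u) ∷ []) ∷ (~⇒≢ v~w ∷ []) ∷ [] ∷ []
      ; closed   = u~v ∷ v~w ∷ w~u ∷ [-]
      }

    no-square : ∀ {u v w z} → u ≢ w → v ≢ z → u ~ v → v ~ w → w ~ z → z ~ u → ⊥
    no-square {u} {v} {w} {z} u≢w v≢z u~v v~w w~z z~u = acyclic record
      { start    = u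
      ; rest     = v ∷ w ∷ z ∷ []
      ; long     = s≤s (s≤s z≤n)
      ; distinct = (~⇒≢ u~v ∷ u≢w ∷ ≢-sym (~⇒≢ z~u) ∷ []) ∷ (~⇒≢ v~w ∷ v≢z ∷ []) ∷ (~⇒≢ w~z ∷ []) ∷ [] ∷ []
      ; closed   = u~v ∷ v~w ∷ w~z ∷ z~u ∷ [-]
      }

    neighbours-disjoint : ∀ {u v} → u ~ v → Unique (neighbours u ++ neighbours v)
    neighbours-disjoint {u} {v} u~v = Unique.++⁺ (neighbours-unique u) (neighbours-unique v)
      (λ (p , q) → no-triangle u~v (∈-neighbours⁻ q) (~-sym (∈-neighbours⁻ p)))

    degree+degree≤n : ∀ {u v} → u ~ v → degree u ℕ.+ degree v ≤ n
    degree+degree≤n {u} u~v =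
      subst (_≤ n) (List.length-++ (neighbours u)) (length-unique (neighbours-disjoint u~v))

    -- The two neighbourhoods are disjoint and already hold n vertices, so a vertex in neither would
    -- be one too many.
    dominating : ∀ {u v} → u ~ v → n ≤ degree u ℕ.+ degree v → ∀ w → u ~ w ⊎ v ~ w
    dominating {u} {v} u~v full w with u ~? w | v ~? w
    ... | yes u~w | _       = inj₁ u~w
    ... | no _    | yes v~w = inj₂ v~w
    ... | no u≁w  | no v≁w  = contradiction
      (subst (λ d → suc d ≤ n) (List.length-++ (neighbours u)) (length-unique unique))
      (ℕ.<⇒≱ (s≤s full))
      where
      unique : Unique (w ∷ neighbours u ++ neighbours v)
      unique = All.tabulate (λ x∈ → λ { refl → [ (λ p → u≁w (∈-neighbours⁻ p)) , (λ p → v≁w (∈-neighbours⁻ p)) ]′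
                                                 (∈-++⁻ (neighbours u) x∈) })
             ∷ neighbours-disjoint u~v

    module DominatingEdge {u v} (u~v : u ~ v) (dominated : ∀ w → u ~ w ⊎ v ~ w) where

      -- A neighbour z ≠ u of w would itself be adjacent to u, closing the triangle u w z, or to v,
      -- closing the square u w z v.
      leaf-neighbour : ∀ {w z} → u ~ w → w ≢ v → w ~ z → z ≡ u
      leaf-neighbour {w} {z} u~w w≢v w~z with z Fin.≟ u | dominated z
      ... | yes z≡u | _        = z≡u
      ... | no _    | inj₁ u~z = ⊥-elim (no-triangle u~w w~z (~-sym u~z))
      ... | no z≢u  | inj₂ v~z = ⊥-elim (no-square (≢-sym z≢u) w≢v u~w w~z (~-sym v~z) (~-sym u~v))

  -- Recognition of double stars

  module DoubleStar (acyclic : Acyclic) {u v} (u~v : u ~ v)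
                    (dominated : ∀ w → u ~ w ⊎ v ~ w) where
    open AcyclicGraph acyclic
    open DominatingEdge u~v dominated
    open DominatingEdge (~-sym u~v) (λ w → [ inj₂ , inj₁ ]′ (dominated w))
      using () renaming (leaf-neighbour to leaf-neighbour′)

    leaf-degree : ∀ {w} → w ≢ u → w ≢ v → degree w ≤ 1
    leaf-degree {w} w≢u w≢v with dominated w
    ... | inj₁ u~w = degree≤length {xs = u ∷ []} (λ w~z → here (leaf-neighbour u~w w≢v w~z))
    ... | inj₂ v~w = degree≤length {xs = v ∷ []} (λ w~z → here (leaf-neighbour′ v~w w≢u w~z))

    -- A relation rather than a function, because a vertex of `G` inherits its role from its index
    -- in the model, through `vertex`.
    HasRole : Role → Fin n → Set
    HasRole centre₁ w = w ≡ u
    HasRole centre₂ w = w ≡ v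
    HasRole leaf₁   w = u ~ w × w ≢ v
    HasRole leaf₂   w = v ~ w × w ≢ u

    -- Apart from loops at a centre, each forbidden adjacency closes a triangle, except between
    -- leaves of different centres, where `leaf-neighbour` decides.
    roles-joined⁺ : ∀ r s {p q} → HasRole r p → HasRole s q → p ~ q → T (joined r s)
    roles-joined⁺ centre₁ centre₁ refl refl p~q = ⊥-elim (~-irrefl refl p~q)
    roles-joined⁺ centre₁ centre₂ _ _ _ = _
    roles-joined⁺ centre₁ leaf₁   _ _ _ = _
    roles-joined⁺ centre₁ leaf₂   refl (v~q , _) p~q = no-triangle u~v v~q (~-sym p~q)
    roles-joined⁺ centre₂ centre₁ _ _ _ = _
    roles-joined⁺ centre₂ centre₂ refl refl p~q = ⊥-elim (~-irrefl refl p~q)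
    roles-joined⁺ centre₂ leaf₁   refl (u~q , _) p~q = no-triangle u~q (~-sym p~q) (~-sym u~v)
    roles-joined⁺ centre₂ leaf₂   _ _ _ = _
    roles-joined⁺ leaf₁   centre₁ _ _ _ = _
    roles-joined⁺ leaf₁   centre₂ (u~p , _) refl p~q = no-triangle u~p p~q (~-sym u~v)
    roles-joined⁺ leaf₁   leaf₁   (u~p , _) (u~q , _) p~q = no-triangle u~p p~q (~-sym u~q)
    roles-joined⁺ leaf₁   leaf₂   (u~p , p≢v) (_ , q≢u) p~q = q≢u (leaf-neighbour u~p p≢v p~q)
    roles-joined⁺ leaf₂   centre₁ (v~p , _) refl p~q = no-triangle u~v v~p p~q
    roles-joined⁺ leaf₂   centre₂ _ _ _ = _
    roles-joined⁺ leaf₂   leaf₁   (_ , p≢u) (u~q , q≢v) p~q = p≢u (leaf-neighbour u~q q≢v (~-sym p~q))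
    roles-joined⁺ leaf₂   leaf₂   (v~p , _) (v~q , _) p~q = no-triangle v~p p~q (~-sym v~q)

    roles-joined⁻ : ∀ r s {p q} → HasRole r p → HasRole s q → T (joined r s) → p ~ q
    roles-joined⁻ centre₁ centre₂ refl refl _ = u~v
    roles-joined⁻ centre₁ leaf₁   refl (u~q , _) _ = u~q
    roles-joined⁻ centre₂ centre₁ refl refl _ = ~-sym u~v
    roles-joined⁻ centre₂ leaf₂   refl (v~q , _) _ = v~q
    roles-joined⁻ leaf₁   centre₁ (u~p , _) refl _ = ~-sym u~p
    roles-joined⁻ leaf₂   centre₂ (v~p , _) refl _ = ~-sym v~p

    otherNeighbours : Fin n → Fin n → List (Fin n)
    otherNeighbours w z = filter (λ p → ¬? (p Fin.≟ z)) (neighbours w)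

    ∈-otherNeighbours⁺ : ∀ {w z p} → w ~ p → p ≢ z → p ∈ otherNeighbours w z
    ∈-otherNeighbours⁺ w~p p≢z = ∈-filter⁺ _ (∈-neighbours⁺ w~p) p≢z

    ∈-otherNeighbours⁻ : ∀ {w z p} → p ∈ otherNeighbours w z → w ~ p × p ≢ z
    ∈-otherNeighbours⁻ {w} {z} p∈ =
      let (p∈N , p≢z) = ∈-filter⁻ (λ p → ¬? (p Fin.≟ z)) {xs = neighbours w} p∈ in ∈-neighbours⁻ p∈N , p≢z

    length-otherNeighbours : ∀ {w z} → w ~ z → suc (length (otherNeighbours w z)) ≡ degree w
    length-otherNeighbours {w} {z} w~z = ℕ.≤-antisym
      (length≤degree
        (All.tabulate (λ p∈ → ≢-sym (proj₂ (∈-otherNeighbours⁻ p∈))) ∷ Unique.filter⁺ _ (neighbours-unique w))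
        (λ { (here refl) → w~z ; (there p∈) → proj₁ (∈-otherNeighbours⁻ p∈) }))
      (degree≤length split)
      where
      split : ∀ {p} → w ~ p → p ∈ z ∷ otherNeighbours w z
      split {p} w~p with p Fin.≟ z
      ... | yes p≡z = here p≡z
      ... | no  p≢z = there (∈-otherNeighbours⁺ w~p p≢z)

    private
      L₁ = otherNeighbours u v
      L₂ = otherNeighbours v u
      x = length L₁
      y = length L₂

    vertex : Fin (2 ℕ.+ (x ℕ.+ y)) → Fin n
    vertex zero          = u
    vertex (suc zero)    = v
    vertex (suc (suc i)) = [ lookup L₁ , lookup L₂ ]′ (splitAt x i)

    vertex-role : ∀ i → HasRole (role x y i) (vertex i)
    vertex-role zero       = refl
    vertex-role (suc zero) = refl
    vertex-role (suc (suc i)) with splitAt x i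
    ... | inj₁ j = ∈-otherNeighbours⁻ (∈-lookup {xs = L₁} j)
    ... | inj₂ j = ∈-otherNeighbours⁻ (∈-lookup {xs = L₂} j)

    vertex-surjective : ∀ w → ∃[ i ] vertex i ≡ w
    vertex-surjective w with w Fin.≟ u | w Fin.≟ v
    ... | yes w≡u | _       = zero , sym w≡u
    ... | no _    | yes w≡v = suc zero , sym w≡v
    ... | no w≢u  | no w≢v with dominated w
    ...   | inj₁ u~w = suc (suc (index w∈ ↑ˡ y)) ,
              trans (cong [ lookup L₁ , lookup L₂ ]′ (Fin.splitAt-↑ˡ x (index w∈) y)) (sym (lookup-index w∈))
      where w∈ = ∈-otherNeighbours⁺ u~w w≢v
    ...   | inj₂ v~w = suc (suc (x ↑ʳ index w∈)) ,
              trans (cong [ lookup L₁ , lookup L₂ ]′ (Fin.splitAt-↑ʳ x y (index w∈))) (sym (lookup-index w∈))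
      where w∈ = ∈-otherNeighbours⁺ v~w w≢u

    position : Fin n → Fin (2 ℕ.+ (x ℕ.+ y))
    position w = proj₁ (vertex-surjective w)

    vertex-position : ∀ w → vertex (position w) ≡ w
    vertex-position w = proj₂ (vertex-surjective w)

    position-injective : ∀ {p q} → position p ≡ position q → p ≡ q
    position-injective {p} {q} eq = trans (sym (vertex-position p)) (trans (cong vertex eq) (vertex-position q))

    position-role : ∀ w → HasRole (role x y (position w)) w
    position-role w = subst (HasRole (role x y (position w))) (vertex-position w) (vertex-role (position w))

    -- `position` is a section of `vertex`, hence injective; equal numbers of vertices make it onto,
    -- which stands in for a proof that `vertex` is injective.
    ≅-doubleStar : ∀ {a b} → degree u ≡ suc a → degree v ≡ suc b → n ≡ 2 ℕ.+ (a ℕ.+ b) → G ≅ doubleStar a b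
    ≅-doubleStar {a} {b} du dv n≡ = subst₂ (λ a b → G ≅ doubleStar a b) x≡a y≡b
      (mk↔ₛ′ position vertex position-vertex vertex-position , λ p q → mk⇔
        (roles-joined⁺ (role x y (position p)) (role x y (position q)) (position-role p) (position-role q))
        (roles-joined⁻ (role x y (position p)) (role x y (position q)) (position-role p) (position-role q)))
      where
      x≡a : x ≡ a
      x≡a = ℕ.suc-injective (trans (length-otherNeighbours u~v) du)
      y≡b : y ≡ b
      y≡b = ℕ.suc-injective (trans (length-otherNeighbours (~-sym u~v)) dv)
      position-vertex : ∀ i → position (vertex i) ≡ i
      position-vertex i =
        let (w , eq) = injective⇒surjective position
              (ℕ.≤-reflexive (trans (cong₂ (λ a b → 2 ℕ.+ (a ℕ.+ b)) x≡a y≡b) (sym n≡))) position-injective i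
        in trans (cong (λ i → position (vertex i)) (sym eq)) (trans (cong position (vertex-position w)) eq)

-- The double star as a tree

module _ (x y : ℕ) where
  open Graph (doubleStar x y) hiding (IsTree)

  private
    c₁ c₂ : Fin (2 ℕ.+ (x ℕ.+ y))
    c₁ = zero
    c₂ = suc zero

  role-centre₁ : ∀ w → role x y w ≡ centre₁ → w ≡ c₁
  role-centre₁ zero eq = refl
  role-centre₁ (suc (suc i)) eq with splitAt x i | eq
  ... | inj₁ _ | ()
  ... | inj₂ _ | ()

  role-centre₂ : ∀ w → role x y w ≡ centre₂ → w ≡ c₂
  role-centre₂ (suc zero) eq = refl
  role-centre₂ (suc (suc i)) eq with splitAt x i | eq
  ... | inj₁ _ | ()
  ... | inj₂ _ | ()

  joined-leaf₁ : ∀ {r} → T (joined leaf₁ r) → r ≡ centre₁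
  joined-leaf₁ {centre₁} _ = refl

  joined-leaf₂ : ∀ {r} → T (joined leaf₂ r) → r ≡ centre₂
  joined-leaf₂ {centre₂} _ = refl

  -- A leaf is adjacent to its centre only, so it cannot have two distinct neighbours.
  inner-vertex : ∀ {p q r} → p ~ q → q ~ r → p ≢ r → q ≡ c₁ ⊎ q ≡ c₂
  inner-vertex {p} {q} {r} p~q q~r p≢r with role x y q in eq
  ... | centre₁ = inj₁ (role-centre₁ q eq)
  ... | centre₂ = inj₂ (role-centre₂ q eq)
  ... | leaf₁   = contradiction
    (trans (role-centre₁ p (joined-leaf₁ (joined-sym (role x y p) leaf₁ p~q))) (sym (role-centre₁ r (joined-leaf₁ q~r)))) p≢r
  ... | leaf₂   = contradiction
    (trans (role-centre₂ p (joined-leaf₂ (joined-sym (role x y p) leaf₂ p~q))) (sym (role-centre₂ r (joined-leaf₂ q~r)))) p≢r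

  two-centres : ∀ {p q r} → p ≡ c₁ ⊎ p ≡ c₂ → q ≡ c₁ ⊎ q ≡ c₂ → r ≡ c₁ ⊎ r ≡ c₂ →
                p ≢ q → q ≢ r → p ≢ r → ⊥
  two-centres (inj₁ refl) (inj₁ refl) _           p≢q _ _ = p≢q refl
  two-centres (inj₂ refl) (inj₂ refl) _           p≢q _ _ = p≢q refl
  two-centres (inj₁ refl) (inj₂ refl) (inj₁ refl) _ _ p≢r = p≢r refl
  two-centres (inj₁ refl) (inj₂ refl) (inj₂ refl) _ q≢r _ = q≢r refl
  two-centres (inj₂ refl) (inj₁ refl) (inj₁ refl) _ q≢r _ = q≢r refl
  two-centres (inj₂ refl) (inj₁ refl) (inj₂ refl) _ _ p≢r = p≢r refl

  -- A cycle has at least three vertices, each between two distinct others.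
  doubleStar-acyclic : Acyclic
  doubleStar-acyclic record { long = s≤s () ; rest = _ ∷ [] }
  doubleStar-acyclic record { start = s ; rest = p ∷ q ∷ [] ; closed = s~p ∷ p~q ∷ q~s ∷ [-]
                            ; distinct = (s≢p ∷ s≢q ∷ []) ∷ (p≢q ∷ []) ∷ _ } =
    two-centres (inner-vertex s~p p~q s≢q) (inner-vertex p~q q~s (≢-sym s≢p)) (inner-vertex q~s s~p (≢-sym p≢q))
                p≢q (≢-sym s≢q) (≢-sym s≢p)
  doubleStar-acyclic record { start = s ; rest = p ∷ q ∷ r ∷ [] ; closed = s~p ∷ p~q ∷ q~r ∷ r~s ∷ [-]
                            ; distinct = (s≢p ∷ s≢q ∷ s≢r ∷ []) ∷ (p≢q ∷ p≢r ∷ []) ∷ (q≢r ∷ []) ∷ _ } =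
    two-centres (inner-vertex s~p p~q s≢q) (inner-vertex p~q q~r p≢r) (inner-vertex q~r r~s (≢-sym s≢q)) p≢q q≢r p≢r
  -- From five vertices on, the path `s`, `p`, `q`, `r`, `t` alone yields three inner vertices; the
  -- shorter cycles above also need their closing edge.
  doubleStar-acyclic record { start = s ; rest = p ∷ q ∷ r ∷ t ∷ _ ; closed = s~p ∷ p~q ∷ q~r ∷ r~t ∷ _
                            ; distinct = (s≢p ∷ s≢q ∷ _) ∷ (p≢q ∷ p≢r ∷ _) ∷ (q≢r ∷ q≢t ∷ _) ∷ _ } =
    two-centres (inner-vertex s~p p~q s≢q) (inner-vertex p~q q~r p≢r) (inner-vertex q~r r~t q≢t) p≢q q≢r p≢r

  path-to-c₁ : ∀ w → Star _~_ w c₁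
  path-to-c₁ w with role x y w in eq
  ... | centre₁ = subst (λ w → Star _~_ w c₁) (sym (role-centre₁ w eq)) Star.ε
  ... | centre₂ = subst (λ w → Star _~_ w c₁) (sym (role-centre₂ w eq)) (_ ◅ Star.ε)
  ... | leaf₁   = subst (λ r → T (joined r centre₁)) (sym eq) _ ◅ Star.ε
  ... | leaf₂   = _◅_ {j = c₂} (subst (λ r → T (joined r centre₂)) (sym eq) _) (_ ◅ Star.ε)

  doubleStar-isTree : IsTree (doubleStar x y)
  doubleStar-isTree = record
    { nonEmpty  = s≤s z≤n
    ; connected = λ u v → path-to-c₁ u ◅◅ Star.reverse (λ {p} {q} → ~-sym {p} {q}) (path-to-c₁ v)
    ; acyclic   = doubleStar-acyclic
    }

  leaf₁-vertex : Fin x → Fin (2 ℕ.+ (x ℕ.+ y))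
  leaf₁-vertex i = suc (suc (i ↑ˡ y))

  leaf₂-vertex : Fin y → Fin (2 ℕ.+ (x ℕ.+ y))
  leaf₂-vertex i = suc (suc (x ↑ʳ i))

  c₁~leaf₁ : ∀ i → c₁ ~ leaf₁-vertex i
  c₁~leaf₁ i rewrite Fin.splitAt-↑ˡ x i y = _

  c₂~leaf₂ : ∀ i → c₂ ~ leaf₂-vertex i
  c₂~leaf₂ i rewrite Fin.splitAt-↑ʳ x y i = _

  -- A lower bound suffices, since the double star is always the larger side of the comparison.
  degree-c₁ : suc x ≤ degree c₁
  degree-c₁ = subst (_≤ degree c₁) (cong suc (trans (List.length-map leaf₁-vertex (allFin x)) (length-allFin x)))
    (length≤degree (doubleStar x y) {v = c₁} unique adjacent)
    where
    unique : Unique (c₂ ∷ map leaf₁-vertex (allFin x))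
    unique = All.map⁺ (All.tabulate (λ _ ()))
           ∷ Unique.map⁺ (λ eq → Fin.↑ˡ-injective y _ _ (Fin.suc-injective (Fin.suc-injective eq))) (Unique.allFin⁺ x)
    adjacent : ∀ {w} → w ∈ c₂ ∷ map leaf₁-vertex (allFin x) → c₁ ~ w
    adjacent (here refl) = _
    adjacent (there w∈) with ∈-map⁻ leaf₁-vertex w∈
    ... | i , _ , refl = c₁~leaf₁ i

  degree-c₂ : suc y ≤ degree c₂
  degree-c₂ = subst (_≤ degree c₂) (cong suc (trans (List.length-map leaf₂-vertex (allFin y)) (length-allFin y)))
    (length≤degree (doubleStar x y) {v = c₂} unique adjacent)
    where
    unique : Unique (c₁ ∷ map leaf₂-vertex (allFin y))
    unique = All.map⁺ (All.tabulate (λ _ ()))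
           ∷ Unique.map⁺ (λ eq → Fin.↑ʳ-injective x _ _ (Fin.suc-injective (Fin.suc-injective eq))) (Unique.allFin⁺ y)
    adjacent : ∀ {w} → w ∈ c₁ ∷ map leaf₂-vertex (allFin y) → c₂ ~ w
    adjacent (here refl) = _
    adjacent (there w∈) with ∈-map⁻ leaf₂-vertex w∈
    ... | i , _ , refl = c₂~leaf₂ i

  c₁c₂∈edges : (c₁ , c₂) ∈ edges
  c₁c₂∈edges = ∈-edges⁺ (doubleStar x y) (s≤s z≤n) _

-- Comparison with the balanced double star

-- With x = a + t and b = y + t, the difference xy - ab is t(y - a), positive for t > 0 because a <
-- x ≤ y.
balanced-half : ∀ {a b x y} → x ≤ y → a ≤ x → a ℕ.+ b ≡ x ℕ.+ y →
                (a ≡ x × b ≡ y) ⊎ a ℕ.* b < x ℕ.* y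
balanced-half {a} {b} {x} {y} x≤y a≤x sum with ℕ.m≤n⇒∃[o]m+o≡n a≤x
... | zero  , refl = inj₁ (sym (ℕ.+-identityʳ a) , ℕ.+-cancelˡ-≡ a b y (trans sum (cong (ℕ._+ y) (ℕ.+-identityʳ a))))
... | suc t , refl with ℕ.+-cancelˡ-≡ a b (suc t ℕ.+ y) (trans sum (ℕ.+-assoc a (suc t) y))
...   | refl = inj₂ (begin-strict
  a ℕ.* (suc t ℕ.+ y)          ≡⟨ ℕ.*-distribˡ-+ a (suc t) y ⟩
  a ℕ.* suc t ℕ.+ a ℕ.* y      <⟨ ℕ.+-monoˡ-< (a ℕ.* y) (ℕ.*-monoˡ-< (suc t) (ℕ.<-≤-trans (ℕ.m<m+n a (s≤s z≤n)) x≤y)) ⟩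
  y ℕ.* suc t ℕ.+ a ℕ.* y      ≡⟨ solve 3 (λ a t y → y :* t :+ a :* y := (a :+ t) :* y) refl a (suc t) y ⟩
  (a ℕ.+ suc t) ℕ.* y          ∎)
  where
  open ℕ.≤-Reasoning
  open +-*-Solver

-- One of a, b is at most x, since otherwise a + b ≥ 2x + 2 > x + y; `balanced-half` then applies,
-- after a swap if necessary.
balanced-max : ∀ {a b x y} → x ≤ y → y ≤ suc x → a ℕ.+ b ≡ x ℕ.+ y →
               (a ≡ x × b ≡ y) ⊎ (a ≡ y × b ≡ x) ⊎ a ℕ.* b < x ℕ.* y
balanced-max {a} {b} {x} {y} x≤y y≤1+x sum with ℕ.≤-<-connex a x | ℕ.≤-<-connex b x
... | inj₁ a≤x | _        = Sum.map₂ inj₂ (balanced-half x≤y a≤x sum)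
... | inj₂ _   | inj₁ b≤x with balanced-half x≤y b≤x (trans (ℕ.+-comm b a) sum)
...   | inj₁ (b≡x , a≡y) = inj₂ (inj₁ (a≡y , b≡x))
...   | inj₂ ba<xy       = inj₂ (inj₂ (subst (_< x ℕ.* y) (ℕ.*-comm b a) ba<xy))
balanced-max {a} {b} {x} {y} x≤y y≤1+x sum | inj₂ x<a | inj₂ x<b =
  contradiction (subst (suc x ℕ.+ suc x ≤_) sum (ℕ.+-mono-≤ x<a x<b)) (ℕ.<⇒≱ (s≤s (ℕ.+-monoʳ-≤ x y≤1+x)))

balanced-bound : ∀ a b {x y} → x ≤ y → y ≤ suc x → a ℕ.+ b ≤ x ℕ.+ y → a ℕ.* b ≤ x ℕ.* y
balanced-bound a b {x} {y} x≤y y≤1+x a+b≤ with ℕ.m≤n⇒∃[o]m+o≡n a+b≤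
... | t , eq = ℕ.≤-trans (ℕ.*-monoʳ-≤ a (ℕ.m≤m+n b t))
  (maximal (balanced-max x≤y y≤1+x (trans (sym (ℕ.+-assoc a b t)) eq)))
  where
  maximal : ∀ {c} → (a ≡ x × c ≡ y) ⊎ (a ≡ y × c ≡ x) ⊎ a ℕ.* c < x ℕ.* y → a ℕ.* c ≤ x ℕ.* y
  maximal (inj₁ (refl , refl))        = ℕ.≤-refl
  maximal (inj₂ (inj₁ (refl , refl))) = ℕ.≤-reflexive (ℕ.*-comm y x)
  maximal (inj₂ (inj₂ ac<xy))         = ℕ.<⇒≤ ac<xy

-- A form of 1 ≤ (m - 1)(n - 1).
m+n≤m*n : ∀ {m n} → 2 ≤ m → 2 ≤ n → m ℕ.+ n ≤ m ℕ.* n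
m+n≤m*n {suc (suc a)} {suc (suc b)} (s≤s (s≤s _)) (s≤s (s≤s _)) =
  subst (suc (suc a) ℕ.+ suc (suc b) ≤_) (expand a b) (ℕ.m≤m+n _ (a ℕ.* b ℕ.+ (a ℕ.+ b)))
  where
  open +-*-Solver
  expand : ∀ a b → (suc (suc a) ℕ.+ suc (suc b)) ℕ.+ (a ℕ.* b ℕ.+ (a ℕ.+ b)) ≡ suc (suc a) ℕ.* suc (suc b)
  expand = solve 2 (λ a b → ((con 2 :+ a) :+ (con 2 :+ b)) :+ (a :* b :+ (a :+ b)) := (con 2 :+ a) :* (con 2 :+ b)) refl

-- With X = 2 + j this bounds X(X + 1), hence XY, by the factor of `expSum-grow`. Equality at j = 0
-- shows why 6 is needed there.
quadratic≤2^ : ∀ j → (2 ℕ.+ j) ℕ.* (3 ℕ.+ j) ≤ 2 ^ j ℕ.* 6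
quadratic≤2^ zero    = ℕ.≤-refl
quadratic≤2^ (suc j) = begin
  (3 ℕ.+ j) ℕ.* (4 ℕ.+ j)               ≤⟨ ℕ.m≤m+n _ (j ℕ.* (3 ℕ.+ j)) ⟩
  (3 ℕ.+ j) ℕ.* (4 ℕ.+ j) ℕ.+ j ℕ.* (3 ℕ.+ j)
    ≡⟨ solve 1 (λ j → (con 3 :+ j) :* (con 4 :+ j) :+ j :* (con 3 :+ j) := con 2 :* ((con 2 :+ j) :* (con 3 :+ j))) refl j ⟩
  2 ℕ.* ((2 ℕ.+ j) ℕ.* (3 ℕ.+ j))       ≤⟨ ℕ.*-monoʳ-≤ 2 (quadratic≤2^ j) ⟩
  2 ℕ.* (2 ^ j ℕ.* 6)                   ≡⟨ ℕ.*-assoc 2 (2 ^ j) 6 ⟨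
  2 ^ suc j ℕ.* 6                       ∎
  where
  open ℕ.≤-Reasoning
  open +-*-Solver

<ℝ-from-⅛ : ∀ (a b : ℝ) → Eventually (λ m → seq a m + ⅛ ℚ.≤ seq b m) → a <ℝ b
<ℝ-from-⅛ a b h = ⅛ , ℚ.positive⁻¹ ⅛ , h

-- The star on four vertices loses only because of the pendent edges of
-- doubleStar 1 1: 3e³ < e⁴ + 2e², although 3e³ > e⁴.
star₄-bound : Eventually (λ m → ι 3 * expSum 3 m + ⅛ ℚ.≤ seq (eM₂ (doubleStar 1 1)) m)
-- Index 12 is past 2k for every k used here, as `expSum-bounds` requires, and suffices for e³ <
-- 41/2, e⁴ > 54 and e² > 29/4.
star₄-bound = 12 , λ m 12≤m → begin
  ι 3 * expSum 3 m + ⅛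
    ≤⟨ ℚ.+-monoˡ-≤ ⅛ (*-monoʳ-≤ (0≤ι 3) (ℚ.≤-trans (proj₂ (expSum-bounds 3 12 (ℕ.m≤m+n 6 6) m 12≤m))
         (toWitness {a? = expSum 3 12 + expTail 3 12 ℚ.≤? + 41 / 2} _))) ⟩
  ι 3 * (+ 41 / 2) + ⅛
    ≤⟨ toWitness {a? = ι 3 * (+ 41 / 2) + ⅛ ℚ.≤? + 54 / 1 + (+ 29 / 4 + (+ 29 / 4 + 0ℚ))} _ ⟩
  + 54 / 1 + (+ 29 / 4 + (+ 29 / 4 + 0ℚ))
    ≤⟨ ℚ.+-mono-≤ {+ 54 / 1} (four m 12≤m) (ℚ.+-mono-≤ {+ 29 / 4} (two m 12≤m) (ℚ.+-monoˡ-≤ 0ℚ (two m 12≤m))) ⟩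
  -- The edge list of `doubleStar 1 1` evaluates to the central edge followed by two pendent edges
  -- of weight 2.
  expSum 4 m + (expSum 2 m + (expSum 2 m + 0ℚ)) ∎
  where
  open ℚ.≤-Reasoning
  four : ∀ m → 12 ≤ m → + 54 / 1 ℚ.≤ expSum 4 m
  four m h = ℚ.≤-trans (toWitness {a? = + 54 / 1 ℚ.≤? expSum 4 12} _) (proj₁ (expSum-bounds 4 12 (ℕ.m≤m+n 8 4) m h))
  two : ∀ m → 12 ≤ m → + 29 / 4 ℚ.≤ expSum 2 m
  two m h = ℚ.≤-trans (toWitness {a? = + 29 / 4 ℚ.≤? expSum 2 12} _) (proj₁ (expSum-bounds 2 12 (ℕ.m≤m+n 4 8) m h))

-- `y ≡ 1` forces `j` to be 0, which leaves the star on four vertices: three edges of weight 3.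
star-bound : ∀ {j y} → suc j ≤ y → y ≡ 1 →
  Eventually (λ m → ι (suc (suc j ℕ.+ y)) * expSum (suc (suc j ℕ.+ y)) m + ⅛ ℚ.≤ seq (eM₂ (doubleStar (suc j) y)) m)
star-bound {zero}  _        refl = star₄-bound
star-bound {suc _} (s≤s ()) refl

-- Edge weights and the estimates of `eM₂`

module _ {n} (G : Graph n) where
  open Graph G

  weight : Fin n × Fin n → ℕ
  weight (u , v) = degree u ℕ.* degree v

  eM₂≤ : ∀ {K} m → (∀ {e} → e ∈ edges → weight e ≤ K) →
         seq (eM₂ G) m ℚ.≤ ι (length edges) * expSum K m
  eM₂≤ m h = sum≤ _ m edges (λ e∈ → expSum-monoˡ m (h e∈))

  ≤eM₂ : ∀ m {e} → e ∈ edges → expSum (weight e) m ℚ.≤ seq (eM₂ G) m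
  ≤eM₂ m e∈ = ≤sum _ m (λ e → 0≤expSum (weight e) m) e∈

  eM₂≤-except : ∀ {K} m {e₀} → (∀ {e} → e ∈ edges → e ≢ e₀ → weight e ≤ K) → e₀ ∈ edges →
                seq (eM₂ G) m ℚ.≤ expSum (weight e₀) m + ι (length edges) * expSum K m
  eM₂≤-except {K} m h = sum≤-except _ m (0≤expSum K m) (edges-unique G) (λ e∈ e≢ → expSum-monoˡ m (h e∈ e≢))

expSum≤eM₂-doubleStar : ∀ x y m → expSum (suc x ℕ.* suc y) m ℚ.≤ seq (eM₂ (doubleStar x y)) m
expSum≤eM₂-doubleStar x y m = ℚ.≤-trans
  (expSum-monoˡ m (ℕ.*-mono-≤ (degree-c₁ x y) (degree-c₂ x y)))
  (≤eM₂ (doubleStar x y) m (c₁c₂∈edges x y))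

-- `s` stands for `eM₂` of the balanced double star, known here through its central edge; the finer
-- bound for four vertices is handed to `all-pendent`. Leaf count `suc j` makes X = 2 + j, the
-- increase of the exponent in `expSum-dominates`.
module Comparison {n j y} (x≤y : suc j ≤ y) (y≤1+x : y ≤ 2 ℕ.+ j) (n≡ : n ≡ 2 ℕ.+ (suc j ℕ.+ y))
                  (s : ℝ) (s-large : ∀ m → expSum ((2 ℕ.+ j) ℕ.* suc y) m ℚ.≤ seq s m)
                  (G : Graph n) (acyclic : Graph.Acyclic G) where
  open Graph G
  open AcyclicGraph G acyclic

  x X Y : ℕ
  x = suc j
  X = suc x
  Y = suc y

  n≡X+Y : n ≡ X ℕ.+ Y
  n≡X+Y = trans n≡ (cong suc (sym (ℕ.+-suc x y)))

  degree≤ : ∀ w → degree w ≤ X ℕ.+ y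
  degree≤ w = ℕ.≤-pred (subst (degree w <_) n≡ (degree<n G w))

  maximum-degree : ∃[ i ] (∀ w → degree w ≤ degree i)
  maximum-degree = argmax (subst Fin (sym n≡) zero) degree

  hub : Fin n
  hub = proj₁ maximum-degree

  hub-max : ∀ w → degree w ≤ degree hub
  hub-max = proj₂ maximum-degree

  edges≤nonNeighbours*degree : length edges ≤ length (nonNeighbours G hub) ℕ.* degree hub
  edges≤nonNeighbours*degree = length-edges G no-triangle hub hub-max

  -- Mantel's argument: the degree of `hub` and the number of its non-neighbours sum to at most X +
  -- Y, so the balanced product bounds theirs.
  edges≤XY : length edges ≤ X ℕ.* Y
  edges≤XY = ℕ.≤-trans edges≤nonNeighbours*degree
    (balanced-bound (length (nonNeighbours G hub)) (degree hub) {X} {Y} (s≤s x≤y) (s≤s y≤1+x)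
      (subst₂ _≤_ (ℕ.+-comm (degree hub) _) n≡X+Y (degree+nonNeighbours G hub)))

  -- A vertex of degree n - 1 leaves `hub` with at most one non-neighbour, itself. For the star on
  -- four vertices Mantel's count 4 would be too weak, as 4e³ > e⁴ + 2e².
  few-edges : (∃[ w ] suc (x ℕ.+ y) ≤ degree w) → length edges ≤ suc (x ℕ.+ y)
  few-edges (w , large) = ℕ.≤-trans edges≤nonNeighbours*degree (ℕ.≤-trans
    (ℕ.*-mono-≤ (ℕ.+-cancelˡ-≤ (suc (x ℕ.+ y)) _ _ (ℕ.≤-trans
                   (ℕ.+-monoˡ-≤ (length (nonNeighbours G hub)) (ℕ.≤-trans large (hub-max w)))
                   (ℕ.≤-trans (degree+nonNeighbours G hub) (ℕ.≤-reflexive (trans n≡ (ℕ.+-comm 1 (suc (x ℕ.+ y))))))))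
                (degree≤ hub)) (ℕ.≤-reflexive (ℕ.*-identityˡ (suc (x ℕ.+ y)))))

  XY≤2^ : X ℕ.* Y ≤ 2 ^ j ℕ.* 6
  XY≤2^ = ℕ.≤-trans (ℕ.*-monoʳ-≤ X (s≤s y≤1+x)) (quadratic≤2^ j)

  -- The step from X(Y - 1) to XY raises the exponent by X = j + 2, written in the shape that
  -- `expSum-dominates` produces.
  XY≡ : j ℕ.+ (2 ℕ.+ y ℕ.* X) ≡ X ℕ.* Y
  XY≡ = solve 2 (λ j y → j :+ (con 2 :+ y :* (con 2 :+ j)) := (con 2 :+ j) :* (con 1 :+ y)) refl j y
    where open +-*-Solver

  uniform-weights : ∀ K N → (∀ {e} → e ∈ edges → weight G e ≤ K) → length edges ≤ N →
                    Eventually (λ m → ι N * expSum K m + ⅛ ℚ.≤ seq s m) → eM₂ G <ℝ s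
  uniform-weights K N h count = λ bound → <ℝ-from-⅛ (eM₂ G) s (eventually-map
    (λ m → ℚ.≤-trans (ℚ.+-monoˡ-≤ ⅛ (ℚ.≤-trans (eM₂≤ G m h) (*-monoˡ-≤ (0≤expSum K m) (ι-mono count)))))
    bound)

  small-weights : (∀ {e} → e ∈ edges → weight G e ≤ y ℕ.* X) → eM₂ G <ℝ s
  small-weights h = uniform-weights (y ℕ.* X) (X ℕ.* Y) h edges≤XY
    (eventually-map (λ m dominated → ℚ.≤-trans dominated
                       (subst (λ k → expSum k m ℚ.≤ seq s m) (sym XY≡) (s-large m)))
                    (expSum-dominates (X ℕ.* Y) (y ℕ.* X) j XY≤2^))

  -- Strictness puts the light weights at most at K = X(Y - 1) - 1, so XY copies of e^K fit below
  -- e^P with P = XY - 1. The heavy edge takes a second e^P, and 2e^P is below e^(XY).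
  one-heavy-edge : ∀ {e₀} → e₀ ∈ edges → weight G e₀ < X ℕ.* Y →
                   (∀ {e} → e ∈ edges → e ≢ e₀ → weight G e < y ℕ.* X) → eM₂ G <ℝ s
  one-heavy-edge {e₀} e₀∈ heavy light = <ℝ-from-⅛ (eM₂ G) s
    (eventually-zip bound (expSum-dominates (X ℕ.* Y) K j XY≤2^) (expSum-double P))
    where
    open ℚ.≤-Reasoning
    open ℚSolver.+-*-Solver
    K = ℕ.pred (y ℕ.* X)
    P = j ℕ.+ (2 ℕ.+ K)
    1+K≡yX : suc K ≡ y ℕ.* X
    1+K≡yX = ℕ.suc-pred (y ℕ.* X) ⦃ ℕ.>-nonZero (ℕ.*-mono-≤ {1} {y} {1} {X} (ℕ.≤-trans (s≤s z≤n) x≤y) (s≤s z≤n)) ⦄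
    1+P≡XY : suc P ≡ X ℕ.* Y
    1+P≡XY = trans (trans (sym (ℕ.+-suc j (2 ℕ.+ K))) (cong (λ k → j ℕ.+ (2 ℕ.+ k)) 1+K≡yX)) XY≡
    bound : ∀ m → ι (X ℕ.* Y) * expSum K m + ⅛ ℚ.≤ expSum P m → ι 2 * expSum P m + ⅛ ℚ.≤ expSum (suc P) m →
            seq (eM₂ G) m + ⅛ ℚ.≤ seq s m
    bound m dominated doubled = begin
      seq (eM₂ G) m + ⅛
        ≤⟨ ℚ.+-monoˡ-≤ ⅛ (eM₂≤-except G m
             (λ e∈ e≢ → ℕ.≤-pred (ℕ.≤-trans (light e∈ e≢) (ℕ.≤-reflexive (sym 1+K≡yX)))) e₀∈) ⟩
      (expSum (weight G e₀) m + ι (length edges) * expSum K m) + ⅛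
        ≤⟨ ℚ.+-monoˡ-≤ ⅛ (ℚ.+-mono-≤ (expSum-monoˡ m (ℕ.≤-pred (subst (weight G e₀ <_) (sym 1+P≡XY) heavy)))
             (ℚ.≤-trans (*-monoˡ-≤ (0≤expSum K m) (ι-mono edges≤XY)) (ℚ.≤-trans (p≤p+q (ℚ.nonNegative⁻¹ ⅛)) dominated))) ⟩
      (expSum P m + expSum P m) + ⅛
        ≡⟨ solve 1 (λ s → (s :+ s) :+ con ⅛ := con (ι 2) :* s :+ con ⅛) refl (expSum P m) ⟩
      ι 2 * expSum P m + ⅛  ≤⟨ doubled ⟩
      expSum (suc P) m      ≡⟨ cong (λ k → expSum k m) 1+P≡XY ⟩
      expSum (X ℕ.* Y) m    ≤⟨ s-large m ⟩
      seq s m         ∎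

  pendent-weight : ∀ {p q K} → degree p ≤ 1 ⊎ degree q ≤ 1 → degree p ≤ K → degree q ≤ K → weight G (p , q) ≤ K
  pendent-weight {p} {q} {K} (inj₁ dp≤1) _ dq≤K = subst (weight G (p , q) ≤_) (ℕ.*-identityˡ K) (ℕ.*-mono-≤ dp≤1 dq≤K)
  pendent-weight {p} {q} {K} (inj₂ dq≤1) dp≤K _ = subst (weight G (p , q) ≤_) (ℕ.*-identityʳ K) (ℕ.*-mono-≤ dp≤K dq≤1)

  2≤X : 2 ≤ X
  2≤X = s≤s (s≤s z≤n)

  module _ {u v} (uv∈ : (u , v) ∈ edges) (full : degree u ℕ.+ degree v ≡ n) where

    private
      u~v : u ~ v
      u~v = proj₂ (∈-edges⁻ G uv∈)

      dominated : ∀ w → u ~ w ⊎ v ~ w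
      dominated = dominating u~v (ℕ.≤-reflexive (sym full))

      full≡ : degree u ℕ.+ degree v ≡ 2 ℕ.+ (x ℕ.+ y)
      full≡ = trans full n≡

      module DS  = DoubleStar G acyclic u~v dominated
      module DS′ = DoubleStar G acyclic (~-sym u~v) (λ w → Sum.swap (dominated w))

    leaf-end : ∀ {p q} → (p , q) ∈ edges → (p , q) ≢ (u , v) → degree p ≤ 1 ⊎ degree q ≤ 1
    leaf-end {p} {q} pq∈ pq≢uv with p Fin.≟ u | p Fin.≟ v | q Fin.≟ u | q Fin.≟ v
    ... | no p≢u   | no p≢v   | _        | _        = inj₁ (DS.leaf-degree p≢u p≢v)
    ... | _        | _        | no q≢u   | no q≢v   = inj₂ (DS.leaf-degree q≢u q≢v)
    ... | yes refl | _        | yes refl | _        = ⊥-elim (~-irrefl refl (proj₂ (∈-edges⁻ G pq∈)))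
    ... | yes refl | _        | no _     | yes refl = contradiction refl pq≢uv
    -- The reversed pair is not listed: `edges` puts the smaller end first.
    ... | no _     | yes refl | yes refl | _        = contradiction (proj₁ (∈-edges⁻ G pq∈)) (Fin.<-asym (proj₁ (∈-edges⁻ G uv∈)))
    ... | no _     | yes refl | no _     | yes refl = ⊥-elim (~-irrefl refl (proj₂ (∈-edges⁻ G pq∈)))

    star-leaf-end : degree u ≤ 1 ⊎ degree v ≤ 1 → ∀ {p q} → (p , q) ∈ edges → degree p ≤ 1 ⊎ degree q ≤ 1
    star-leaf-end leaf {p} {q} pq∈ with p Fin.≟ u | q Fin.≟ v
    ... | yes refl | yes refl = leaf
    ... | no p≢u   | _        = leaf-end pq∈ (λ { refl → p≢u refl })
    ... | _        | no q≢v   = leaf-end pq∈ (λ { refl → q≢v refl })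

    star-degree : degree u ≤ 1 ⊎ degree v ≤ 1 → ∃[ w ] suc (x ℕ.+ y) ≤ degree w
    star-degree (inj₁ du≤1) = v , ℕ.≤-pred (subst (_≤ suc (degree v)) full≡ (ℕ.+-monoˡ-≤ (degree v) du≤1))
    star-degree (inj₂ dv≤1) = u , ℕ.≤-pred (subst₂ _≤_ full≡ (ℕ.+-comm (degree u) 1) (ℕ.+-monoʳ-≤ (degree u) dv≤1))

    -- Each central degree is at most n - 2 = x + y, because the other is at least 2. A pendent edge
    -- weighs no more than its inner end's degree, and x + y < yX once y ≥ 2.
    both-inner : 2 ≤ degree u → 2 ≤ degree v → weight G (u , v) < X ℕ.* Y → eM₂ G <ℝ s
    both-inner 2≤du 2≤dv heavy = one-heavy-edge uv∈ heavy (λ { {p , q} pq∈ pq≢ →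
      ℕ.≤-trans (s≤s (pendent-weight (leaf-end pq∈ pq≢) (degree≤′ p) (degree≤′ q))) x+y<yX })
      where
      du≤x+y : degree u ≤ x ℕ.+ y
      du≤x+y = ℕ.≤-pred (ℕ.≤-pred (subst₂ _≤_ (ℕ.+-comm (degree u) 2) full≡ (ℕ.+-monoʳ-≤ (degree u) 2≤dv)))
      dv≤x+y : degree v ≤ x ℕ.+ y
      dv≤x+y = ℕ.≤-pred (ℕ.≤-pred (subst (2 ℕ.+ degree v ≤_) full≡ (ℕ.+-monoˡ-≤ (degree v) 2≤du)))
      degree≤′ : ∀ w → degree w ≤ x ℕ.+ y
      degree≤′ w with w Fin.≟ u | w Fin.≟ v
      ... | yes refl | _        = du≤x+y
      ... | _        | yes refl = dv≤x+y
      ... | no w≢u   | no w≢v   = ℕ.≤-trans (DS.leaf-degree w≢u w≢v) (s≤s z≤n)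
      -- y = 1 would force n = 4, where degrees ≥ 2 give weight 4 = XY.
      2≤y : 2 ≤ y
      2≤y = ℕ.≰⇒> (λ y≤1 → ℕ.<⇒≱ heavy (ℕ.≤-trans
        (ℕ.*-mono-≤ (s≤s (ℕ.≤-trans x≤y y≤1)) (s≤s y≤1)) (ℕ.*-mono-≤ 2≤du 2≤dv)))
      x+y<yX : x ℕ.+ y < y ℕ.* X
      x+y<yX = subst (_≤ y ℕ.* X) (ℕ.+-comm y X) (m+n≤m*n 2≤y 2≤X)

    -- The balanced degrees may occur in either order; `DS′` reads the centres in reverse.
    unbalanced : ¬ G ≅ doubleStar x y → weight G (u , v) < X ℕ.* Y
    unbalanced G≇S with balanced-max (s≤s x≤y) (s≤s y≤1+x) (trans full n≡X+Y)
    ... | inj₁ (du , dv)        = contradiction (DS.≅-doubleStar du dv n≡) G≇S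
    ... | inj₂ (inj₁ (du , dv)) = contradiction (DS′.≅-doubleStar dv du n≡) G≇S
    ... | inj₂ (inj₂ smaller)   = smaller

  -- The largest possible weight X + y is at most yX for y ≥ 2. At y = 1 it is 3 against 2, hence
  -- the separate bound `star`.
  all-pendent : (∀ {p q} → (p , q) ∈ edges → degree p ≤ 1 ⊎ degree q ≤ 1) →
                (∃[ w ] suc (x ℕ.+ y) ≤ degree w) →
                (y ≡ 1 → Eventually (λ m → ι (suc (x ℕ.+ y)) * expSum (suc (x ℕ.+ y)) m + ⅛ ℚ.≤ seq s m)) →
                eM₂ G <ℝ s
  all-pendent pendent large star = by-cases (y ℕ.≟ 1)
    where
    by-cases : Dec (y ≡ 1) → eM₂ G <ℝ s
    by-cases (yes y≡1) = uniform-weights (suc (x ℕ.+ y)) (suc (x ℕ.+ y))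
      (λ { {p , q} pq∈ → pendent-weight (pendent pq∈) (degree≤ p) (degree≤ q) }) (few-edges large) (star y≡1)
    by-cases (no y≢1) = small-weights (λ { {p , q} pq∈ → ℕ.≤-trans
      (pendent-weight (pendent pq∈) (degree≤ p) (degree≤ q))
      (subst (_≤ y ℕ.* X) (ℕ.+-comm y X) (m+n≤m*n (ℕ.≤∧≢⇒< (ℕ.≤-trans (s≤s z≤n) x≤y) (≢-sym y≢1)) 2≤X)) })

acyclic<doubleStar : ∀ {n j y} (x≤y : suc j ≤ y) (y≤1+x : y ≤ 2 ℕ.+ j) → n ≡ 2 ℕ.+ (suc j ℕ.+ y) →
  (G : Graph n) → Graph.Acyclic G → ¬ G ≅ doubleStar (suc j) y → eM₂ G <ℝ eM₂ (doubleStar (suc j) y)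
acyclic<doubleStar {n} {j} {y} x≤y y≤1+x n≡ G acyclic G≇S = by-edges (All.all? sparse? edges)
  where
  open Graph G
  open Comparison x≤y y≤1+x n≡ (eM₂ (doubleStar (suc j) y)) (expSum≤eM₂-doubleStar (suc j) y) G acyclic
  sparse? = λ ((u , v) : Fin n × Fin n) → degree u ℕ.+ degree v ℕ.<? n
  module _ {u v} (uv∈ : (u , v) ∈ edges) (¬small : ¬ degree u ℕ.+ degree v < n) where
    full : degree u ℕ.+ degree v ≡ n
    full = ℕ.≤-antisym (AcyclicGraph.degree+degree≤n G acyclic (proj₂ (∈-edges⁻ G uv∈))) (ℕ.≮⇒≥ ¬small)
    star : degree u ≤ 1 ⊎ degree v ≤ 1 → eM₂ G <ℝ eM₂ (doubleStar (suc j) y)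
    star leaf = all-pendent (star-leaf-end uv∈ full leaf) (star-degree uv∈ full leaf) (star-bound x≤y)
    by-degrees : degree u ≤ 1 ⊎ 1 < degree u → degree v ≤ 1 ⊎ 1 < degree v → eM₂ G <ℝ eM₂ (doubleStar (suc j) y)
    by-degrees (inj₁ du≤1) _           = star (inj₁ du≤1)
    by-degrees (inj₂ _)    (inj₁ dv≤1) = star (inj₂ dv≤1)
    by-degrees (inj₂ 2≤du) (inj₂ 2≤dv) = both-inner uv∈ full 2≤du 2≤dv (unbalanced uv∈ full G≇S)
  by-edges : Dec (All (λ (u , v) → degree u ℕ.+ degree v < n) edges) → eM₂ G <ℝ eM₂ (doubleStar (suc j) y)
  -- The degree sum is now at most n - 1 = y + X with y ≤ X ≤ y + 1, so `y` and `X` form the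
  -- balanced pair.
  by-edges (yes sparse) = small-weights (λ {e} e∈ → balanced-bound (degree (proj₁ e)) (degree (proj₂ e)) {y} {X} y≤1+x (s≤s x≤y)
    (ℕ.≤-trans (ℕ.≤-pred (ℕ.≤-trans (All.lookup sparse e∈) (ℕ.≤-reflexive n≡))) (ℕ.≤-reflexive (ℕ.+-comm X y))))
  by-edges (no ¬sparse) =
    let ((u , v) , uv∈ , ¬small) = find (All.¬All⇒Any¬ sparse? edges ¬sparse)
    in by-degrees uv∈ ¬small (ℕ.≤-<-connex (degree u) 1) (ℕ.≤-<-connex (degree v) 1)

-- Variable `x`, `y` and an equation for `n` let `refl` identify the vertex types of `G` and the
-- double star, which the halves of n - 2 would not permit. For x = 0 the hypotheses give 2 ≤ y ≤ 1.
balanced-doubleStar-larger : ∀ x y → 2 ≤ x ℕ.+ y → x ≤ y → y ≤ suc x →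
  ∀ n → 2 ℕ.+ (x ℕ.+ y) ≡ n → (G : Graph n) → IsTree G → ¬ (G ≅ doubleStar x y) →
  ∃[ H ] (IsTree {n} H × eM₂ H >ℝ eM₂ G)
balanced-doubleStar-larger zero    _ 2≤y _ y≤1 = contradiction 2≤y (ℕ.<⇒≱ (s≤s y≤1))
balanced-doubleStar-larger (suc j) y _ x≤y y≤1+x _ refl G tree G≇S =
  doubleStar (suc j) y , doubleStar-isTree (suc j) y ,
  acyclic<doubleStar x≤y y≤1+x refl G (IsTree.acyclic tree) G≇S

-- Both sides unfold to floors, of (n + 1)/2 and (n + 2)/2.
⌈n/2⌉≤1+⌊n/2⌋ : ∀ n → ⌈ n /2⌉ ≤ suc ⌊ n /2⌋
⌈n/2⌉≤1+⌊n/2⌋ n = ℕ.⌊n/2⌋-mono (ℕ.n≤1+n (suc n))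

theorem1 : ∀ (n : ℕ) → 4 ≤ n →
    ∀ (T : Graph n) → IsTree T →
    ¬ (T ≅ doubleStar ⌊ n ∸ 2 /2⌋ ⌈ n ∸ 2 /2⌉) →
    ∃[ T″ ] (IsTree {n} T″ × eM₂ T″ >ℝ eM₂ T)
theorem1 n 4≤n = balanced-doubleStar-larger ⌊ k /2⌋ ⌈ k /2⌉
  (subst (2 ≤_) (sym halves-sum) (ℕ.∸-monoˡ-≤ 2 4≤n))
  (ℕ.⌊n/2⌋≤⌈n/2⌉ k) (⌈n/2⌉≤1+⌊n/2⌋ k)
  n (trans (cong (2 ℕ.+_) halves-sum) (ℕ.m+[n∸m]≡n (ℕ.≤-trans (s≤s (s≤s z≤n)) 4≤n)))
  where
  k = n ∸ 2
  halves-sum : ⌊ k /2⌋ ℕ.+ ⌈ k /2⌉ ≡ k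
  halves-sum = ℕ.⌊n/2⌋+⌈n/2⌉≡n k
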